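{- For any $k$-edge graph $H$ without isolated vertices, $AR_o(H) \leq k^2$. Moreover, $AR_o(P_k) \leq \binom{k}{2}+1$ for every $k\geq 1$, $AR_o(C_k) \leq \binom{k}{2}+1$ for every $k\geq 3$, and $AR_o(K_n) \leq n^4/4$ for every $n\geq 2$.
   Context: All graphs are finite and simple. $P_k$ is the path with $k$ edges, $C_k$ the cycle with $k$ edges, $K_n$ the complete graph on $n$ vertices. An edge-coloring (with natural numbers as colors) is proper if adjacent edges receive distinct colors; an edge-colored graph is rainbow if all its edges have distinct colors. A copy of $H$ is a (not necessarily induced) subgraph isomorphic to $H$. The online anti-Ramsey number $AR_o(H)$ is defined by a game between Builder and Painter: Builder creates vertices and edges, one edge at a time (the graph stays simple); immediately after each edge is built, Painter irrevocably colors it so that the coloring stays proper. Both players have complete information. $AR_o(H)$ is the smallest $t$ such that Builder has a strategy which, against every Painter, guarantees a rainbow copy of $H$ after at most $t$ edges have been built and colored. -}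

module Defs where

open import Data.Fin using (Fin; toℕ)
import Data.Fin as Fin
import Data.Fin.Properties as Fin
open import Data.List using (List; []; _∷_; length; filter; allFin; cartesianProduct)
open import Data.List.Membership.Propositional using (_∈_)
open import Data.List.Relation.Unary.All using (All)
open import Data.List.Relation.Unary.Any using (Any)
open import Data.Nat using (ℕ; suc; _≤_; s≤s; _≟_)
open import Data.Nat.Properties using (1+n≢n)
open import Data.Product using (∃-syntax; _×_; _,_)
open import Data.Sum using (_⊎_; inj₁; inj₂; swap; [_,_]′)
open import Function.Definitions using (Injective)
open import Level using (0ℓ)
open import Relation.Binary using (Rel; Symmetric; Irreflexive; Decidable)
open import Relation.Binary.PropositionalEquality using (_≡_; _≢_; refl; sym; trans; cong; subst; ≢-sym)
open import Relation.Nullary using (¬_)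
open import Relation.Nullary.Decidable using (_×-dec_; _⊎-dec_; ¬?)

record Graph : Set₁ where
  field
    order  : ℕ
    Adj    : Rel (Fin order) 0ℓ
    adj?   : Decidable Adj
    adjSym : Symmetric Adj
    irrefl : Irreflexive _≡_ Adj

open Graph public

-- Each edge is listed once, with its smaller endpoint first.
edges : (H : Graph) → List (Fin (order H) × Fin (order H))
edges H = filter (λ (i , j) → (i Fin.<? j) ×-dec adj? H i j)
                 (cartesianProduct (allFin (order H)) (allFin (order H)))

size : Graph → ℕ
size H = length (edges H)

NoIsolated : Graph → Set
NoIsolated H = ∀ i → ∃[ j ] Adj H i j

-- The path with k edges, hence k + 1 vertices.
path : ℕ → Graph
path k = record
  { order  = suc k
  ; Adj    = λ i j → Next i j ⊎ Next j i
  ; adj?   = λ i j → (suc (toℕ i) ≟ toℕ j) ⊎-dec (suc (toℕ j) ≟ toℕ i)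
  ; adjSym = swap
  ; irrefl = λ { refl → [ 1+n≢n , 1+n≢n ]′ }
  }
  where
  Next : Rel (Fin (suc k)) 0ℓ
  Next i j = suc (toℕ i) ≡ toℕ j

module _ (k : ℕ) where

  CyclicNext : Rel (Fin k) 0ℓ
  CyclicNext i j = suc (toℕ i) ≡ toℕ j ⊎ (suc (toℕ i) ≡ k × toℕ j ≡ 0)

  cyclicNext? : Decidable CyclicNext
  cyclicNext? i j =
    (suc (toℕ i) ≟ toℕ j) ⊎-dec ((suc (toℕ i) ≟ k) ×-dec (toℕ j ≟ 0))

  cyclicNext-irrefl : 3 ≤ k → ∀ {i} → ¬ CyclicNext i i
  cyclicNext-irrefl _   (inj₁ eq)       = 1+n≢n eq
  cyclicNext-irrefl 3≤k (inj₂ (eq , z))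
    with s≤s () ← subst (3 ≤_) (trans (sym eq) (cong suc z)) 3≤k

  cycle : 3 ≤ k → Graph
  cycle 3≤k = record
    { order  = k
    ; Adj    = λ i j → CyclicNext i j ⊎ CyclicNext j i
    ; adj?   = λ i j → cyclicNext? i j ⊎-dec cyclicNext? j i
    ; adjSym = swap
    ; irrefl = λ { refl → [ cyclicNext-irrefl 3≤k , cyclicNext-irrefl 3≤k ]′ }
    }

complete : ℕ → Graph
complete n = record
  { order  = n
  ; Adj    = _≢_
  ; adj?   = λ i j → ¬? (i Fin.≟ j)
  ; adjSym = ≢-sym
  ; irrefl = λ eq neq → neq eq
  }

-- An edge already built and coloured in the game. The two endpoints are
-- stored in some order, which Joins and Incident disregard.
record ColouredEdge : Set where
  constructor colouredEdge
  field
    end₁ end₂ colour : ℕ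

open ColouredEdge public

Joins : ColouredEdge → ℕ → ℕ → Set
Joins e u v = (end₁ e ≡ u × end₂ e ≡ v) ⊎ (end₁ e ≡ v × end₂ e ≡ u)

Incident : ColouredEdge → ℕ → Set
Incident e u = end₁ e ≡ u ⊎ end₂ e ≡ u

-- Vertices are named by natural numbers. Creating a vertex costs nothing,
-- so every name is available to Builder at any time and only the coloured
-- edges are recorded.
Board : Set
Board = List ColouredEdge

Buildable : Board → ℕ → ℕ → Set
Buildable G u v = u ≢ v × ¬ Any (λ e → Joins e u v) G

ProperColour : Board → ℕ → ℕ → ℕ → Set
ProperColour G u v c =
  All (λ e → Incident e u ⊎ Incident e v → colour e ≢ c) G

-- A board reached in the game never contains two edges joining the same
-- vertices, so e ≡ e′ below says that e and e′ are the same edge of the copy.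
record RainbowCopy (H : Graph) (G : Board) : Set where
  field
    embed     : Fin (order H) → ℕ
    injective : Injective _≡_ _≡_ embed

  InCopy : ColouredEdge → Set
  InCopy e = e ∈ G ×
    ∃[ i ] ∃[ j ] (Adj H i j × Joins e (embed i) (embed j))

  field
    present : ∀ {i j} → Adj H i j →
              ∃[ e ] (e ∈ G × Joins e (embed i) (embed j))
    rainbow : ∀ {e e′} → InCopy e → InCopy e′ →
              colour e ≡ colour e′ → e ≡ e′

-- Builder's strategies, as trees, for obtaining a rainbow copy of H from the
-- board G after at most t further edges, whatever proper colours Painter uses.
data Forces (H : Graph) : ℕ → Board → Set where
  done  : ∀ {t G} → RainbowCopy H G → Forces H t G
  build : ∀ {t G} (u v : ℕ) → Buildable G u v →
          (∀ c → ProperColour G u v c → Forces H t (colouredEdge u v c ∷ G)) →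
          Forces H (suc t) G

-- a is the online anti-Ramsey number of H.
IsARₒ : Graph → ℕ → Set
IsARₒ H a = Forces H a [] × (∀ t → Forces H t [] → a ≤ t)

{-# OPTIONS --safe #-}

-- Say that a colour of the partial rainbow copy is missing at a board vertex u if
-- no edge at u has it. When Painter repeats a colour of the copy on a new edge at
-- u, that colour stops being missing at u, so every vertex of the copy sees at most
-- one failure per colour.
--
-- For general H, embed the vertices one by one, each next vertex v having maximum
-- degree in the graph left; let f(v) be its degree into the later vertices. A fresh
-- candidate for v is joined to the earlier neighbours, latest first, until Painter
-- repeats a colour. By the choice of the order, an attempt failing at u has used
-- at most f(u) edges, and u causes at most k - 1 failures. As the f(u) add up to k,
-- at most k(k - 1) edges are wasted and k edges form the copy.
--
-- A path is extended by pendant edges at an end. For a cycle, a path with k - 2 edges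
-- is closed through a fresh vertex; choosing which end to extend leaves few colours
-- missing at one of the ends. For complete graphs, 2k ≤ n².
--
-- The least number of edges exists constructively because the game is decidable:
-- all vertices and colours not yet on the board are interchangeable.

module Submission where

open import Defs
open import Data.Fin as Fin using (Fin; zero; suc; toℕ; fromℕ; fromℕ<; inject₁; opposite; finToFun; funToFin)
import Data.Fin.Properties as Fin
open import Data.List using (List; []; _∷_; _++_; length; filter; map; allFin; cartesianProduct)
open import Data.List.Extrema.Nat using (argmax; argmax-sel; f[⊥]≤f[argmax]; f[xs]≤f[argmax])
open import Data.List.Membership.DecPropositional using (_∈?_)
open import Data.List.Membership.Propositional using (_∈_; _∉_; find; lose)
open import Data.List.Membership.Propositional.Properties
  using (∈-map⁺; ∈-map⁻; ∈-∃++; ∈-++⁺ˡ; ∈-++⁺ʳ; ∈-++⁻; ∈-allFin)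
open import Data.List.Properties
  using (map-id-local; map-++; length-map; length-++; length-filter; length-tabulate; filter-++; filter-accept; filter-reject)
open import Data.List.Relation.Binary.Permutation.Propositional as Perm
  using (_↭_; prep; swap; ↭-refl; ↭-reflexive; ↭-sym; ↭-trans)
open import Data.List.Relation.Binary.Permutation.Propositional.Properties using (map⁺; shift; ↭-length; ∈-resp-↭)
open import Data.List.Relation.Binary.Subset.Propositional using (_⊆_)
open import Data.List.Relation.Unary.All as All using (All; []; _∷_)
import Data.List.Relation.Unary.All.Properties as All
open import Data.List.Relation.Unary.AllPairs using (AllPairs; []; _∷_)
import Data.List.Relation.Unary.AllPairs.Properties as AllPairs
open import Data.List.Relation.Unary.Any as Any using (Any; here; there)
import Data.List.Relation.Unary.Any.Properties as Any
open import Data.Nat using (ℕ; zero; suc; _+_; _*_; _^_; _⊔_; _≤_; _<_; z≤n; s≤s; _≟_)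
open import Data.Nat.Combinatorics using (_C_; nC1≡n; nCk+nC[k+1]≡[n+1]C[k+1])
open import Data.Nat.Induction using (Acc; acc; <-wellFounded)
open import Data.Nat.ListAction using (sum)
open import Data.Nat.ListAction.Properties using (sum-↭)
open import Data.Nat.Properties hiding (_≟_)
open import Data.Nat.Tactic.RingSolver using (solve-∀)
open import Data.Product using (∃; ∃-syntax; _×_; _,_; proj₁; proj₂)
open import Data.Sum as Sum using (_⊎_; inj₁; inj₂; [_,_]′)
open import Data.Unit using (⊤; tt)
import Data.Vec.Functional as Vector
open import Function using (_∘_; id)
open import Function.Definitions using (Injective)
open import Level using (0ℓ)
open import Relation.Binary.PropositionalEquality
  using (_≡_; _≢_; refl; sym; trans; cong; cong₂; subst; subst₂)
open import Relation.Nullary using (¬_; Dec; yes; no; contradiction)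
open import Relation.Nullary.Decidable using (_×-dec_; _⊎-dec_; _→-dec_; ¬?; map′)
open import Relation.Unary using (Pred; Decidable)

-- Renaming of vertices and colours

Involutive : (ℕ → ℕ) → Set
Involutive f = ∀ n → f (f n) ≡ n

involutive⇒injective : ∀ {f} → Involutive f → ∀ {m n} → f m ≡ f n → m ≡ n
involutive⇒injective {f} inv {m} {n} eq = trans (sym (inv m)) (trans (cong f eq) (inv n))

transpose : ℕ → ℕ → ℕ → ℕ
transpose a b n with n ≟ a | n ≟ b
... | yes _ | _     = b
... | no _  | yes _ = a
... | no _  | no _  = n

transpose-matchˡ : ∀ a b → transpose a b a ≡ b
transpose-matchˡ a b with a ≟ a
... | yes _   = refl
... | no  a≢a = contradiction refl a≢a

transpose-matchʳ : ∀ a b → transpose a b b ≡ a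
transpose-matchʳ a b with b ≟ a | b ≟ b
... | yes b≡a | _       = b≡a
... | no _    | yes _   = refl
... | no _    | no  b≢b = contradiction refl b≢b

transpose-other : ∀ {a b n} → n ≢ a → n ≢ b → transpose a b n ≡ n
transpose-other {a} {b} {n} n≢a n≢b with n ≟ a | n ≟ b
... | yes n≡a | _       = contradiction n≡a n≢a
... | no _    | yes n≡b = contradiction n≡b n≢b
... | no _    | no _    = refl

transpose-involutive : ∀ a b → Involutive (transpose a b)
transpose-involutive a b n with n ≟ a | n ≟ b
... | yes refl | _        = transpose-matchʳ n b
... | no _     | yes refl = transpose-matchˡ a n
... | no n≢a   | no n≢b   = transpose-other n≢a n≢b

transpose-below : ∀ {N a b n} → N ≤ a → N ≤ b → n < N → transpose a b n ≡ n
transpose-below N≤a N≤b n<N =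
  transpose-other (<⇒≢ (<-≤-trans n<N N≤a)) (<⇒≢ (<-≤-trans n<N N≤b))

rename : (f g : ℕ → ℕ) → ColouredEdge → ColouredEdge
rename f g e = colouredEdge (f (end₁ e)) (f (end₂ e)) (g (colour e))

module _ {H : Graph} where

  Playable : ℕ → Board → ℕ → ℕ → Set
  Playable t G u v = Buildable G u v ×
    (∀ c → ProperColour G u v c → Forces H t (colouredEdge u v c ∷ G))

  module Rename (f g : ℕ → ℕ) (f-inv : Involutive f) (g-inv : Involutive g) where

    private
      ρ : ColouredEdge → ColouredEdge
      ρ = rename f g

      f-inj : ∀ {m n} → f m ≡ f n → m ≡ n
      f-inj = involutive⇒injective f-inv

      g-inj : ∀ {m n} → g m ≡ g n → m ≡ n
      g-inj = involutive⇒injective g-inv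

    joins⁺ : ∀ e {u v} → Joins e u v → Joins (ρ e) (f u) (f v)
    joins⁺ _ = Sum.map (λ (p , q) → cong f p , cong f q) (λ (p , q) → cong f p , cong f q)

    joins⁻ : ∀ e {u v} → Joins (ρ e) (f u) (f v) → Joins e u v
    joins⁻ _ = Sum.map (λ (p , q) → f-inj p , f-inj q) (λ (p , q) → f-inj p , f-inj q)

    buildable : ∀ {G u v} → Buildable G u v → Buildable (map ρ G) (f u) (f v)
    buildable (u≢v , new) = u≢v ∘ f-inj , new ∘ Any.map (λ {e} → joins⁻ e) ∘ Any.map⁻

    proper⁻ : ∀ {G u v c} → ProperColour (map ρ G) (f u) (f v) c → ProperColour G u v (g c)
    proper⁻ {G} {c = c} p = All.map
      (λ h inc eq → h (Sum.map (Sum.map (cong f) (cong f)) (Sum.map (cong f) (cong f)) inc)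
                      (trans (cong g eq) (g-inv c)))
      (All.map⁻ p)

    rainbowCopy : ∀ {G} → RainbowCopy H G → RainbowCopy H (map ρ G)
    rainbowCopy {G} R = record
      { embed     = f ∘ embed
      ; injective = injective ∘ f-inj
      ; present   = λ a → let e , e∈G , j = present a in ρ e , ∈-map⁺ ρ e∈G , joins⁺ e j
      ; rainbow   = rainbow′
      }
      where
      open RainbowCopy R
      rainbow′ : ∀ {e e′} →
        e ∈ map ρ G × ∃[ i ] ∃[ j ] (Adj H i j × Joins e (f (embed i)) (f (embed j))) →
        e′ ∈ map ρ G × ∃[ i ] ∃[ j ] (Adj H i j × Joins e′ (f (embed i)) (f (embed j))) →
        colour e ≡ colour e′ → e ≡ e′
      rainbow′ (e∈ , i , j , a , J) (e′∈ , i′ , j′ , a′ , J′) eq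
        with d , d∈ , refl ← ∈-map⁻ ρ e∈ | d′ , d′∈ , refl ← ∈-map⁻ ρ e′∈ =
        cong ρ (rainbow (d∈ , i , j , a , joins⁻ d J) (d′∈ , i′ , j′ , a′ , joins⁻ d′ J′) (g-inj eq))

    -- As `g` is an involution, Painter's answer `c` in the renamed game is `g (g c)`; Builder
    -- continues with the renamed reply to the answer `g c` of the original game.
    playable′ : ∀ {t G u v} → Buildable G u v →
      (∀ c → ProperColour G u v c → Forces H t (map ρ (colouredEdge u v c ∷ G))) →
      Playable t (map ρ G) (f u) (f v)
    playable′ {t} {G} {u} {v} b k = buildable b , λ c p →
      subst (λ c → Forces H t (colouredEdge (f u) (f v) c ∷ map ρ G)) (g-inv c)
            (k (g c) (proper⁻ p))

    forces : ∀ {t G} → Forces H t G → Forces H t (map ρ G)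
    forces (done R)        = done (rainbowCopy R)
    forces (build u v b k) = build (f u) (f v) (proj₁ P) (proj₂ P)
      where P = playable′ b (λ c p → forces (k c p))

    playable : ∀ {t G u v} → Playable t G u v → Playable t (map ρ G) (f u) (f v)
    playable (b , k) = playable′ b (λ c p → forces (k c p))

-- Decidability of the game

private
  _≟ᵉ_ : (e e′ : ColouredEdge) → Dec (e ≡ e′)
  colouredEdge a b c ≟ᵉ colouredEdge a′ b′ c′ =
    map′ (λ { (refl , refl , refl) → refl }) (λ { refl → refl , refl , refl })
         (a ≟ a′ ×-dec b ≟ b′ ×-dec c ≟ c′)

joins? : ∀ e u v → Dec (Joins e u v)
joins? e u v = (end₁ e ≟ u ×-dec end₂ e ≟ v) ⊎-dec (end₁ e ≟ v ×-dec end₂ e ≟ u)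

buildable? : ∀ G u v → Dec (Buildable G u v)
buildable? G u v = ¬? (u ≟ v) ×-dec ¬? (Any.any? (λ e → joins? e u v) G)

incident? : ∀ e u → Dec (Incident e u)
incident? e u = end₁ e ≟ u ⊎-dec end₂ e ≟ u

properColour? : ∀ G u v c → Dec (ProperColour G u v c)
properColour? G u v c =
  All.all? (λ e → (incident? e u ⊎-dec incident? e v) →-dec ¬? (colour e ≟ c)) G

data Bounded (N : ℕ) : ColouredEdge → Set where
  bounded : ∀ {u v c} → u < N → v < N → c < N → Bounded N (colouredEdge u v c)

bounded-mono : ∀ {M N e} → M ≤ N → Bounded M e → Bounded N e
bounded-mono M≤N (bounded u v c) = bounded (<-≤-trans u M≤N) (<-≤-trans v M≤N) (<-≤-trans c M≤N)

bound : (G : Board) → ∃[ N ] All (Bounded N) G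
bound [] = 0 , []
bound (colouredEdge u v c ∷ G) with N , bs ← bound G =
  suc (u ⊔ v ⊔ c) ⊔ N ,
  bounded-mono (m≤m⊔n _ N)
    (bounded (s≤s (≤-trans (m≤m⊔n u v) (m≤m⊔n _ c)))
             (s≤s (≤-trans (m≤n⊔m u v) (m≤m⊔n _ c)))
             (s≤s (m≤n⊔m (u ⊔ v) c)))
  ∷ All.map (bounded-mono (m≤n⊔m _ N)) bs

-- By `collapse`, the name `N` stands for all larger ones, which leaves a finite search up to and
-- including `N`.
some? : ∀ {P : ℕ → Set} → Decidable P → ∀ N → (∀ {n} → N ≤ n → P n → P N) → Dec (∃ P)
some? P? N collapse with anyUpTo? P? (suc N)
... | yes (n , _ , p) = yes (n , p)
... | no  none        = no λ (n , p) → [ (λ n<N → none (n , m≤n⇒m≤1+n n<N , p))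
                                       , (λ N≤n → none (N , ≤-refl , collapse N≤n p)) ]′ (<-≤-connex n N)

every? : ∀ {P : ℕ → Set} → Decidable P → ∀ N → (∀ {n} → N ≤ n → P N → P n) → Dec (∀ n → P n)
every? P? N spread with allUpTo? P? (suc N)
... | no  ¬all = no λ all → ¬all (λ _ → all _)
... | yes all  = yes λ n → [ (λ n<N → all (m≤n⇒m≤1+n n<N)) , (λ N≤n → spread N≤n (all ≤-refl)) ]′
                           (<-≤-connex n N)

module _ (H : Graph) (noIsolated : NoIsolated H) where

  module _ (G : Board) where

    private
      V = Fin (order H)

      InCopyAt : (V → ℕ) → ColouredEdge → Set
      InCopyAt φ e = ∃[ i ] ∃[ j ] (Adj H i j × Joins e (φ i) (φ j))

      -- `RainbowCopy` for a fixed embedding, with every quantifier running over vertices of `H` or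
      -- edges of `G`, hence decidable.
      CopyAt : (V → ℕ) → Set
      CopyAt φ = (∀ i j → φ i ≡ φ j → i ≡ j)
               × (∀ i j → Adj H i j → Any (λ e → Joins e (φ i) (φ j)) G)
               × All (λ e → All (λ e′ → InCopyAt φ e → InCopyAt φ e′ → colour e ≡ colour e′ → e ≡ e′) G) G

      inCopyAt? : ∀ φ e → Dec (InCopyAt φ e)
      inCopyAt? φ e = Fin.any? λ i → Fin.any? λ j → adj? H i j ×-dec joins? e (φ i) (φ j)

      copyAt? : ∀ φ → Dec (CopyAt φ)
      copyAt? φ =
        (Fin.all? λ i → Fin.all? λ j → (φ i ≟ φ j) →-dec (i Fin.≟ j))
        ×-dec (Fin.all? λ i → Fin.all? λ j → adj? H i j →-dec Any.any? (λ e → joins? e (φ i) (φ j)) G)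
        ×-dec All.all? (λ e → All.all? (λ e′ →
                inCopyAt? φ e →-dec (inCopyAt? φ e′ →-dec ((colour e ≟ colour e′) →-dec (e ≟ᵉ e′)))) G) G

      fromCopyAt : ∀ {φ} → CopyAt φ → RainbowCopy H G
      fromCopyAt {φ} (inj , pres , rb) = record
        { embed     = φ
        ; injective = inj _ _
        ; present   = λ {i} {j} a → find (pres i j a)
        ; rainbow   = λ (e∈ , c) (e′∈ , c′) eq → All.lookup (All.lookup rb e∈) e′∈ c c′ eq
        }

      toCopyAt : (R : RainbowCopy H G) → let open RainbowCopy R in
                 ∀ {φ} → (∀ i → φ i ≡ embed i) → CopyAt φ
      toCopyAt R {φ} eq =
          (λ i j e → injective (trans (sym (eq i)) (trans e (eq j))))
        , (λ i j a → let e , e∈ , J = present a in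
             lose e∈ (subst₂ (Joins e) (sym (eq i)) (sym (eq j)) J))
        , All.tabulate λ {e} e∈ → All.tabulate λ {e′} e′∈ c c′ →
            rainbow (e∈ , back e c) (e′∈ , back e′ c′)
        where
        open RainbowCopy R
        back : ∀ e → InCopyAt φ e → InCopyAt embed e
        back e (i , j , a , J) = i , j , a , subst₂ (Joins e) (eq i) (eq j) J

    -- Every vertex of `H` lies on an edge, so its image is an endpoint of an edge of the board and
    -- is below `N`. This leaves finitely many embeddings, which `finToFun` enumerates by codes.
    rainbowCopy? : Dec (RainbowCopy H G)
    rainbowCopy? with N , bs ← bound G
      with Fin.any? (λ code → copyAt? (toℕ ∘ finToFun {N} {order H} code))
    ... | yes (_ , c) = yes (fromCopyAt c)
    ... | no  none    = no λ R → let open RainbowCopy R in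
      let below : ∀ i → embed i < N
          below i = let j , a = noIsolated i ; e , e∈ , J = present a in endpoint (All.lookup bs e∈) J
          ψ = λ i → fromℕ< (below i)
      in none (funToFin ψ , toCopyAt R (λ i →
           trans (cong toℕ (Fin.finToFun-funToFin ψ i)) (Fin.toℕ-fromℕ< (below i))))
      where
      endpoint : ∀ {e u v N} → Bounded N e → Joins e u v → u < N
      endpoint (bounded u v _) (inj₁ (refl , _)) = u
      endpoint (bounded u v _) (inj₂ (_ , refl)) = v

  private
    fixed : ∀ {N G} {f g : ℕ → ℕ} →
            All (Bounded N) G → (∀ {n} → n < N → f n ≡ n) → (∀ {n} → n < N → g n ≡ n) →
            map (rename f g) G ≡ G
    fixed bs f-fix g-fix = map-id-local (All.map
      (λ { (bounded u v c) → fix (f-fix u) (f-fix v) (g-fix c) }) bs)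
      where
      fix : ∀ {u u′ v v′ c c′} → u ≡ u′ → v ≡ v′ → c ≡ c′ → colouredEdge u v c ≡ colouredEdge u′ v′ c′
      fix refl refl refl = refl

    replace : ∀ {t G G′ u u′ v v′} → G ≡ G′ → u ≡ u′ → v ≡ v′ →
              Playable {H} t G u v → Playable t G′ u′ v′
    replace refl refl refl p = p

  -- Any renaming of vertices and colours preserves the game, so all names unused
  -- on the board are equivalent and one of them represents them all.
  mutual

    forces? : ∀ t G → Dec (Forces H t G)
    forces? t G with rainbowCopy? G
    forces? t       G | yes R = yes (done R)
    forces? zero    G | no ¬R = no λ { (done R) → ¬R R }
    forces? (suc t) G | no ¬R with N , bs ← bound G =
      map′ (λ (u , v , b , k) → build u v b k)
           (λ { (done R) → contradiction R ¬R ; (build u v b k) → u , v , b , k })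
           (some? (λ u → some? (playable? t G u) (N ⊔ suc u) (collapseᵛ u)) N collapseᵘ)
      where
      collapseᵛ : ∀ u {v} → N ⊔ suc u ≤ v → Playable t G u v → Playable t G u (N ⊔ suc u)
      collapseᵛ u {v} le p =
        replace (fixed bs (λ n<N → below (<-≤-trans n<N (m≤m⊔n N _))) (λ _ → refl))
                (below (m≤n⊔m N (suc u))) (transpose-matchˡ v _) (R.playable p)
        where
        module R = Rename {H} (transpose v (N ⊔ suc u)) id (transpose-involutive _ _) (λ _ → refl)
        below : ∀ {n} → n < N ⊔ suc u → transpose v (N ⊔ suc u) n ≡ n
        below = transpose-below {N ⊔ suc u} le ≤-refl

      collapseᵘ : ∀ {u} → N ≤ u → ∃ (Playable t G u) → ∃ (Playable t G N)
      collapseᵘ {u} le (v , p) = transpose u N v ,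
        replace (fixed bs (transpose-below le ≤-refl) (λ _ → refl))
                (transpose-matchˡ u N) refl (R.playable p)
        where
        module R = Rename {H} (transpose u N) id (transpose-involutive _ _) (λ _ → refl)

    playable? : ∀ t G u v → Dec (Playable {H} t G u v)
    playable? t G u v with N , bs ← bound G = buildable? G u v ×-dec
      every? (λ c → properColour? G u v c →-dec forces? t (colouredEdge u v c ∷ G)) N spread
      where
      spread : ∀ {c} → N ≤ c →
        (ProperColour G u v N → Forces H t (colouredEdge u v N ∷ G)) →
        (ProperColour G u v c → Forces H t (colouredEdge u v c ∷ G))
      spread {c} le k _ =
        subst₂ (λ c G → Forces H t (colouredEdge u v c ∷ G)) (transpose-matchˡ N c)
          (fixed bs (λ _ → refl) (transpose-below ≤-refl le))
          -- `N` exceeds every colour on the board, so it is a legal answer of Painter.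
          (R.forces (k (All.map (λ { (bounded _ _ c<N) _ → <⇒≢ c<N }) bs)))
        where
        module R = Rename {H} id (transpose N c) (λ _ → refl) (transpose-involutive _ _)

  private
    least : ∀ {P : ℕ → Set} → Decidable P → ∀ {b} → P b → ∃[ a ] ((P a × (∀ t → P t → a ≤ t)) × a ≤ b)
    least P? {zero}  p = 0 , (p , λ _ _ → z≤n) , z≤n
    least {P} P? {suc b} p with P? 0
    ... | yes p₀ = 0 , (p₀ , λ _ _ → z≤n) , z≤n
    ... | no ¬p₀ with a , (pa , min) , a≤b ← least (P? ∘ suc) p =
      suc a , (pa , λ { zero p₀ → contradiction p₀ ¬p₀ ; (suc t) pt → s≤s (min t pt) }) , s≤s a≤b

  forces⇒ARₒ≤ : ∀ {b} → Forces H b [] → ∃[ a ] (IsARₒ H a × a ≤ b)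
  forces⇒ARₒ≤ = least (λ t → forces? t [])

-- Colours missing at a vertex

module _ {A : Set} {P Q : Pred A 0ℓ} (P? : Decidable P) (Q? : Decidable Q)
         (P⊆Q : ∀ {x} → P x → Q x) where

  length-filter-mono : ∀ xs → length (filter P? xs) ≤ length (filter Q? xs)
  length-filter-mono []       = z≤n
  length-filter-mono (x ∷ xs) with P? x | Q? x
  ... | yes _ | yes _ = s≤s (length-filter-mono xs)
  ... | yes p | no ¬q = contradiction (P⊆Q p) ¬q
  ... | no _  | yes _ = m≤n⇒m≤1+n (length-filter-mono xs)
  ... | no _  | no _  = length-filter-mono xs

  length-filter-< : ∀ {x xs} → x ∈ xs → Q x → ¬ P x →
                    length (filter P? xs) < length (filter Q? xs)
  length-filter-< {x} {_ ∷ xs} (here refl) q ¬p with P? x | Q? x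
  ... | yes p | _     = contradiction p ¬p
  ... | no _  | yes _ = s≤s (length-filter-mono xs)
  ... | no _  | no ¬q = contradiction q ¬q
  length-filter-< {xs = y ∷ _} (there x∈) q ¬p with P? y | Q? y
  ... | yes _ | yes _ = s≤s (length-filter-< x∈ q ¬p)
  ... | yes p | no ¬q = contradiction (P⊆Q p) ¬q
  ... | no _  | yes _ = m≤n⇒m≤1+n (length-filter-< x∈ q ¬p)
  ... | no _  | no _  = length-filter-< x∈ q ¬p

Sees : Board → ℕ → ℕ → Set
Sees G u c = Any (λ e → Incident e u × colour e ≡ c) G

sees? : ∀ G u c → Dec (Sees G u c)
sees? G u c = Any.any? (λ e → incident? e u ×-dec (colour e ≟ c)) G

properˡ : ∀ {G u v c} → ProperColour G u v c → ¬ Sees G u c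
properˡ p s = let h , i , eq = All.lookupAny p s in h (inj₁ i) eq

properʳ : ∀ {G u v c} → ProperColour G u v c → ¬ Sees G v c
properʳ p s = let h , i , eq = All.lookupAny p s in h (inj₂ i) eq

-- The number of colours in S that Painter may still use on an edge at u.
miss : Board → ℕ → List ℕ → ℕ
miss G u S = length (filter (λ c → ¬? (sees? G u c)) S)

miss-∷ : ∀ e G u S → miss (e ∷ G) u S ≤ miss G u S
miss-∷ e G u S = length-filter-mono _ _ (λ ¬s → ¬s ∘ there) S

-- The progress made by a failure: a colour of `S` that was missing at `u` is now seen there.
miss-< : ∀ {e G u S} → colour e ∈ S → Incident e u → ¬ Sees G u (colour e) →
         miss (e ∷ G) u S < miss G u S
miss-< c∈ inc ¬s = length-filter-< _ _ (λ ¬s → ¬s ∘ there) c∈ ¬s (λ ¬s′ → ¬s′ (here (inc , refl)))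

miss-new : ∀ G u c S → miss G u (c ∷ S) ≤ suc (miss G u S)
miss-new G u c S with sees? G u c
... | yes _ = n≤1+n _
... | no _  = ≤-refl

miss-seen : ∀ {G u c} → Sees G u c → ∀ S → miss G u (c ∷ S) ≡ miss G u S
miss-seen {G} {u} s S = cong length (filter-reject (λ c → ¬? (sees? G u c)) {xs = S} (λ ¬s → ¬s s))

miss≤length : ∀ G u S → miss G u S ≤ length S
miss≤length G u S = length-filter _ S

-- Simple boards and rainbow copies

joins-sym : ∀ e {u v} → Joins e u v → Joins e v u
joins-sym _ = Sum.swap

Has : Board → ℕ → ℕ → ℕ → Set
Has G u v c = ∃[ e ] (e ∈ G × Joins e u v × colour e ≡ c)

has-sym : ∀ {G u v c} → Has G u v c → Has G v u c
has-sym (e , e∈ , J , eq) = e , e∈ , joins-sym e J , eq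

has-⊆ : ∀ {G G′ u v c} → G ⊆ G′ → Has G u v c → Has G′ u v c
has-⊆ G⊆G′ (e , e∈ , rest) = e , G⊆G′ e∈ , rest

has-new : ∀ {G u v c} → Has (colouredEdge u v c ∷ G) u v c
has-new = _ , here refl , inj₁ (refl , refl) , refl

-- All vertices are below `N`, so `N` itself is the next fresh vertex. By `simple`, an edge of a
-- copy is determined by its endpoints.
record Valid (N : ℕ) (G : Board) : Set where
  field
    below  : All (λ e → end₁ e < N × end₂ e < N) G
    simple : ∀ {e e′ u v} → e ∈ G → e′ ∈ G → Joins e u v → Joins e′ u v → e ≡ e′

open Valid public

valid-[] : ∀ {N} → Valid N []
valid-[] = record { below = [] ; simple = λ () }

valid-mono : ∀ {M N G} → M ≤ N → Valid M G → Valid N G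
valid-mono M≤N V = record
  { below  = All.map (λ (u , v) → <-≤-trans u M≤N , <-≤-trans v M≤N) (below V)
  ; simple = simple V
  }

valid-∷ : ∀ {N G u v} c → Buildable G u v → u < N → v < N → Valid N G →
          Valid N (colouredEdge u v c ∷ G)
valid-∷ {N} {G} {u} {v} c (_ , new) u<N v<N V = record
  { below  = (u<N , v<N) ∷ below V
  ; simple = simple′
  }
  where
  clash : ∀ {e a b} → e ∈ G → Joins (colouredEdge u v c) a b → ¬ Joins e a b
  clash e∈ (inj₁ (refl , refl)) J = new (lose e∈ J)
  clash {e} e∈ (inj₂ (refl , refl)) J = new (lose e∈ (joins-sym e J))

  simple′ : ∀ {e e′ a b} → e ∈ colouredEdge u v c ∷ G → e′ ∈ colouredEdge u v c ∷ G →
            Joins e a b → Joins e′ a b → e ≡ e′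
  simple′ (here refl) (here refl) _ _  = refl
  simple′ (here refl) (there e′∈) J J′ = contradiction J′ (clash e′∈ J)
  simple′ (there e∈)  (here refl) J J′ = contradiction J (clash e∈ J′)
  simple′ (there e∈)  (there e′∈) J J′ = simple V e∈ e′∈ J J′

has-bound : ∀ {N G u v c} → Valid N G → Has G u v c → u < N × v < N
has-bound V (e , e∈ , inj₁ (refl , refl) , _) = All.lookup (below V) e∈
has-bound V (e , e∈ , inj₂ (refl , refl) , _) = let u , v = All.lookup (below V) e∈ in v , u

buildable-fresh : ∀ {N G u} → Valid N G → u < N → Buildable G u N
buildable-fresh V u<N = <⇒≢ u<N , λ a → let e , e∈ , J = find a in
  <-irrefl refl (proj₂ (has-bound V (e , e∈ , J , refl)))

valid-fresh : ∀ {N G u} c → u < N → Valid N G → Valid (suc N) (colouredEdge u N c ∷ G)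
valid-fresh c u<N V =
  valid-∷ c (buildable-fresh V u<N) (m<n⇒m<1+n u<N) ≤-refl (valid-mono (n≤1+n _) V)

-- The edges of the copy are listed by an index type `I`. On a simple board, an edge joining the
-- images of adjacent vertices is the listed one, so distinct colours in the list suffice. Equal
-- colours need only give equal endpoints, which permits several indices for one edge.
colouredCopy : ∀ {N G} (H : Graph) → Valid N G → {I : Set}
  (φ : Fin (order H) → ℕ) → Injective _≡_ _≡_ φ → (src tgt col : I → ℕ) →
  (∀ l → Has G (src l) (tgt l) (col l)) →
  (∀ l l′ → col l ≡ col l′ → src l ≡ src l′ × tgt l ≡ tgt l′) →
  (∀ {i j} → Adj H i j → ∃[ l ] ((src l ≡ φ i × tgt l ≡ φ j) ⊎ (src l ≡ φ j × tgt l ≡ φ i))) →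
  RainbowCopy H G
colouredCopy {G = G} H V {I} φ φ-inj src tgt col has col-inj cover = record
  { embed     = φ
  ; injective = φ-inj
  ; present   = λ a → let e , e∈ , J , _ = hasAdj (cover a) in e , e∈ , J
  ; rainbow   = rainbow′
  }
  where
  Covers : Fin (order H) → Fin (order H) → I → Set
  Covers i j l = (src l ≡ φ i × tgt l ≡ φ j) ⊎ (src l ≡ φ j × tgt l ≡ φ i)

  hasAdj : ∀ {i j} → (p : ∃ (Covers i j)) → Has G (φ i) (φ j) (col (proj₁ p))
  hasAdj (l , inj₁ (refl′ , refl″)) = subst₂ (λ a b → Has G a b (col l)) refl′ refl″ (has l)
  hasAdj (l , inj₂ (p , q)) = has-sym {G} (subst₂ (λ a b → Has G a b (col l)) p q (has l))

  index : ∀ {e i j} → e ∈ G → Adj H i j → Joins e (φ i) (φ j) →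
          ∃[ l ] (Joins e (src l) (tgt l) × colour e ≡ col l)
  index {e} e∈ a J with p ← cover a
    with d , d∈ , K , eq ← hasAdj p
    with refl ← simple V e∈ d∈ J K
    with p
  ... | l , inj₁ (s , t) = l , subst₂ (Joins e) (sym s) (sym t) J , eq
  ... | l , inj₂ (s , t) = l , subst₂ (Joins e) (sym s) (sym t) (joins-sym e J) , eq

  rainbow′ : ∀ {e e′} →
    e ∈ G × ∃[ i ] ∃[ j ] (Adj H i j × Joins e (φ i) (φ j)) →
    e′ ∈ G × ∃[ i ] ∃[ j ] (Adj H i j × Joins e′ (φ i) (φ j)) →
    colour e ≡ colour e′ → e ≡ e′
  rainbow′ {e} {e′} (e∈ , _ , _ , a , J) (e′∈ , _ , _ , a′ , J′) eq
    with l , K , c ← index e∈ a J | l′ , K′ , c′ ← index e′∈ a′ J′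
    with s , t ← col-inj l l′ (trans (sym c) (trans eq c′)) =
    simple V e∈ e′∈ K (subst₂ (Joins e′) (sym s) (sym t) K′)

-- Rainbow paths and cycles

module Paths where

  -- `S` lists exactly the colours of the path: it has length `j` and contains the `j` distinct
  -- values of `col`.
  record RainbowPath (N : ℕ) (G : Board) (j : ℕ) (S : List ℕ) : Set where
    field
      valid      : Valid N G
      vertex     : Fin (suc j) → ℕ
      vertex-inj : Injective _≡_ _≡_ vertex
      vertex<N   : ∀ i → vertex i < N
      col        : Fin j → ℕ
      col-inj    : Injective _≡_ _≡_ col
      edge       : ∀ i → Has G (vertex (inject₁ i)) (vertex (suc i)) (col i)
      col∈       : ∀ i → col i ∈ S
      length-S   : length S ≡ j

    first last : ℕ
    first = vertex zero
    last  = vertex (fromℕ j)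

    first<N : first < N
    first<N = vertex<N zero

    last<N : last < N
    last<N = vertex<N (fromℕ j)

  open RainbowPath

  opposite-inject₁ : ∀ {n} (i : Fin n) → opposite (inject₁ i) ≡ suc (opposite i)
  opposite-inject₁ zero    = refl
  opposite-inject₁ (suc i) = cong inject₁ (opposite-inject₁ i)

  opposite-injective : ∀ {n} → Injective {A = Fin n} _≡_ _≡_ opposite
  opposite-injective {x = i} {j} eq =
    trans (sym (Fin.opposite-involutive i)) (trans (cong opposite eq) (Fin.opposite-involutive j))

  reverse : ∀ {N G j S} → RainbowPath N G j S → RainbowPath N G j S
  reverse {G = G} P = record
    { valid      = valid P
    ; vertex     = vertex P ∘ opposite
    ; vertex-inj = opposite-injective ∘ vertex-inj P
    ; vertex<N   = vertex<N P ∘ opposite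
    ; col        = col P ∘ opposite
    ; col-inj    = opposite-injective ∘ col-inj P
    ; edge       = λ i → subst (λ a → Has G (vertex P a) (vertex P (inject₁ (opposite i))) (col P (opposite i)))
                           (sym (opposite-inject₁ i)) (has-sym {G} (edge P (opposite i)))
    ; col∈       = col∈ P ∘ opposite
    ; length-S   = length-S P
    }

  last-reverse : ∀ {N G j S} (P : RainbowPath N G j S) → last (reverse P) ≡ first P
  last-reverse P = cong (vertex P) (Fin.opposite-involutive zero)

  trivial : RainbowPath 1 [] 0 []
  trivial = record
    { valid      = valid-[]
    ; vertex     = λ _ → 0
    ; vertex-inj = λ { {zero} {zero} _ → refl }
    ; vertex<N   = λ _ → s≤s z≤n
    ; col        = λ ()
    ; col-inj    = λ { {()} }
    ; edge       = λ ()
    ; col∈       = λ ()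
    ; length-S   = refl
    }

  reboard : ∀ {M N G G′ j S} → M ≤ N → Valid N G′ → G ⊆ G′ →
            RainbowPath M G j S → RainbowPath N G′ j S
  reboard M≤N V G⊆G′ P = record
    { valid      = V
    ; vertex     = vertex P
    ; vertex-inj = vertex-inj P
    ; vertex<N   = λ i → <-≤-trans (vertex<N P i) M≤N
    ; col        = col P
    ; col-inj    = col-inj P
    ; edge       = λ i → has-⊆ G⊆G′ (edge P i)
    ; col∈       = col∈ P
    ; length-S   = length-S P
    }

  ∷-injective : ∀ {n a} {f : Fin n → ℕ} → Injective _≡_ _≡_ f → (∀ i → f i ≢ a) →
                Injective _≡_ _≡_ (a Vector.∷ f)
  ∷-injective inj new {zero}  {zero}  _  = refl
  ∷-injective inj new {zero}  {suc j} eq = contradiction (sym eq) (new j)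
  ∷-injective inj new {suc i} {zero}  eq = contradiction eq (new i)
  ∷-injective inj new {suc i} {suc j} eq = cong suc (inj eq)

  module _ {N G j S} (P : RainbowPath N G j S) where

    pendant : ℕ → Board
    pendant c = colouredEdge (first P) N c ∷ G

    pendant-buildable : Buildable G (first P) N
    pendant-buildable = buildable-fresh (valid P) (first<N P)

    keep : ∀ c → RainbowPath (suc N) (pendant c) j S
    keep c = reboard (n≤1+n N) (valid-fresh c (first<N P) (valid P)) there P

    extend : ∀ {c} → c ∉ S → RainbowPath (suc N) (pendant c) (suc j) (c ∷ S)
    extend {c} c∉S = record
      { valid      = valid (keep c)
      ; vertex     = N Vector.∷ vertex P
      ; vertex-inj = ∷-injective (vertex-inj P) (λ i → <⇒≢ (vertex<N P i))
      ; vertex<N   = λ { zero → ≤-refl ; (suc i) → vertex<N (keep c) i }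
      ; col        = c Vector.∷ col P
      ; col-inj    = ∷-injective (col-inj P) (λ { i refl → c∉S (col∈ P i) })
      ; edge       = λ { zero → has-sym {pendant c} (has-new {G}) ; (suc i) → edge (keep c) i }
      ; col∈       = λ { zero → here refl ; (suc i) → there (col∈ P i) }
      ; length-S   = cong suc (length-S P)
      }

    -- The new end `N` sees `c` through the pendant edge, so only the `j` older colours can be
    -- missing there.
    miss-fresh : ∀ c → miss (pendant c) N (c ∷ S) ≤ j
    miss-fresh c = ≤-trans (≤-reflexive (miss-seen {pendant c} (here (inj₂ refl , refl)) S))
                           (≤-trans (miss≤length (pendant c) N S) (≤-reflexive (length-S P)))

  next⇒inject₁ : ∀ {n} {i j : Fin (suc n)} → suc (toℕ i) ≡ toℕ j →
                 ∃[ l ] (inject₁ l ≡ i × suc l ≡ j)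
  next⇒inject₁ {j = suc l} eq =
    l , Fin.toℕ-injective (trans (Fin.toℕ-inject₁ l) (suc-injective (sym eq))) , refl

  pathCopy : ∀ {N G k S} → RainbowPath N G k S → RainbowCopy (path k) G
  pathCopy {k = k} P = colouredCopy (path k) (valid P) (vertex P) (vertex-inj P)
    (vertex P ∘ inject₁) (vertex P ∘ suc) (col P) (edge P)
    (λ l l′ eq → let l≡l′ = col-inj P eq in
       cong (vertex P ∘ inject₁) l≡l′ , cong (vertex P ∘ suc) l≡l′)
    λ { (inj₁ n) → let l , p , q = next⇒inject₁ n in l , inj₁ (cong (vertex P) p , cong (vertex P) q)
      ; (inj₂ n) → let l , p , q = next⇒inject₁ n in l , inj₂ (cong (vertex P) p , cong (vertex P) q) }

  cycleCopy : ∀ {N G j S c} (P : RainbowPath N G (suc j) S) (3≤k : 3 ≤ suc (suc j)) →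
              Has G (last P) (first P) c → c ∉ S → RainbowCopy (cycle (suc (suc j)) 3≤k) G
  cycleCopy {G = G} {j} {c = c} P 3≤k closing c∉S = colouredCopy (cycle _ 3≤k) (valid P)
    (vertex P) (vertex-inj P) (last P Vector.∷ vertex P ∘ inject₁) (first P Vector.∷ vertex P ∘ suc)
    (c Vector.∷ col P)
    (λ { zero → closing ; (suc i) → edge P i })
    (λ l l′ eq → let l≡l′ = ∷-injective {a = c} (col-inj P) (λ { i refl → c∉S (col∈ P i) }) {l} {l′} eq in
       cong (last P Vector.∷ vertex P ∘ inject₁) l≡l′ , cong (first P Vector.∷ vertex P ∘ suc) l≡l′)
    λ { (inj₁ n) → let l , p , q = step n in l , inj₁ (p , q)
      ; (inj₂ n) → let l , p , q = step n in l , inj₂ (p , q) }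
    where
    step : ∀ {i i′} → CyclicNext (suc (suc j)) i i′ → ∃[ l ]
      ((last P Vector.∷ vertex P ∘ inject₁) l ≡ vertex P i × (first P Vector.∷ vertex P ∘ suc) l ≡ vertex P i′)
    step (inj₁ n) with l , refl , refl ← next⇒inject₁ n = suc l , refl , refl
    -- The wrap-around pair of the cycle is the closing edge, which has index `zero`.
    step (inj₂ (p , z)) = zero ,
      cong (vertex P) (Fin.toℕ-injective (trans (Fin.toℕ-fromℕ (suc j)) (sym (suc-injective p)))) ,
      cong (vertex P) (Fin.toℕ-injective (sym z))

  -- Strategies and edge counts for paths and cycles

  [1+n]C2 : ∀ n → suc n C 2 ≡ n + n C 2
  [1+n]C2 n = trans (sym (nCk+nC[k+1]≡[n+1]C[k+1] n 1)) (cong (_+ n C 2) (nC1≡n n))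

  -- The path has j edges and lacks q + 1, and no colour is missing at its end.
  pathCost : (j q : ℕ) → ℕ
  pathCost j zero    = 1
  pathCost j (suc q) = suc (j + pathCost (suc j) q)

  0<pathCost : ∀ j q → 0 < pathCost j q
  0<pathCost j zero    = s≤s z≤n
  0<pathCost j (suc q) = s≤s z≤n

  -- `pathCost j q` is one more than the sum of the numbers from `j + 1` to `j + q`; the binomial
  -- supplies those up to `j`.
  pathCost-C : ∀ j q → pathCost j q + suc j C 2 ≡ suc (j + q) C 2 + 1
  pathCost-C j zero    = trans (+-comm 1 _) (cong (λ n → suc n C 2 + 1) (sym (+-identityʳ j)))
  pathCost-C j (suc q) = begin-equality
    suc (j + pathCost (suc j) q) + suc j C 2   ≡⟨ (λ a b c → solve′ a b c) j (pathCost (suc j) q) (suc j C 2) ⟩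
    pathCost (suc j) q + (suc j + suc j C 2)   ≡⟨ cong (pathCost (suc j) q +_) ([1+n]C2 (suc j)) ⟨
    pathCost (suc j) q + suc (suc j) C 2       ≡⟨ pathCost-C (suc j) q ⟩
    suc (suc j + q) C 2 + 1                    ≡⟨ cong (λ n → suc n C 2 + 1) (+-suc j q) ⟨
    suc (j + suc q) C 2 + 1                    ∎
    where
    open ≤-Reasoning
    solve′ : ∀ a b c → suc (a + b) + c ≡ b + (suc a + c)
    solve′ = solve-∀

  -- Every edge is paid for. A repeated colour lowers the number missing at the first end; a new
  -- colour lengthens the path, and the `suc j` by which `pathCost` drops covers the edge and the at
  -- most `j` colours missing at the new end.
  forcesPath : ∀ {N G j q k S} t (P : RainbowPath N G j S) → j + suc q ≡ k →
               miss G (first P) S + pathCost j q ≤ t → Forces (path k) t G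
  forcesPath {G = G} {j} {q} {S = S} zero P _ le =
    contradiction (≤-trans (0<pathCost j q) (≤-trans (m≤n+m _ (miss G (first P) S)) le)) λ ()
  forcesPath {N} {G} {j} {q} {k} {S} (suc t) P j+q≡k le =
    build (first P) N (pendant-buildable P) reply
    where
    won : ∀ {c} q → j + suc q ≡ k → pathCost j q ≤ suc t → c ∉ S → Forces (path k) t (pendant P c)
    won zero eq _ c∉S rewrite +-comm j 1 | sym eq = done (pathCopy (extend P c∉S))
    won {c} (suc q) eq (s≤s le) c∉S =
      forcesPath {q = q} t (extend P c∉S) (trans (sym (+-suc j (suc q))) eq)
        (≤-trans (+-monoˡ-≤ _ (miss-fresh P c)) le)

    reply : ∀ c → ProperColour G (first P) N c → Forces (path k) t (pendant P c)
    reply c proper with _∈?_ _≟_ c S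
    ... | yes c∈S = forcesPath {q = q} t (keep P c) j+q≡k
      (≤-pred (≤-trans (+-monoˡ-≤ _ (miss-< c∈S (inj₁ refl) (properˡ proper))) le))
    ... | no c∉S  = won q j+q≡k (≤-trans (m≤n+m _ _) le) c∉S

  forces-path : ∀ k → Forces (path (suc k)) (suc k C 2 + 1) []
  forces-path k = forcesPath {q = k} _ trivial refl
    (≤-reflexive (trans (sym (+-identityʳ _)) (pathCost-C 0 k)))

  -- An attempt wastes one edge if Painter repeats a colour at the first end of
  -- the path, and two if he does so at the last end, whence the weights.
  closeCycle : ∀ {N G j S} t a b (P : RainbowPath N G (suc j) S) (3≤k : 3 ≤ 3 + j) →
               miss G (last P) S ≤ a → miss G (first P) S ≤ b →
               2 + (a + a + b) ≤ t → Forces (cycle (3 + j) 3≤k) t G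
  closeCycle {N} {G} {j} {S} (suc (suc t)) a b P 3≤k la fb (s≤s (s≤s le)) =
    build (first P) N (pendant-buildable P) reply₁
    where
    Goal : ℕ → Board → Set
    Goal = Forces (cycle (3 + j) 3≤k)

    module _ (c : ℕ) where

      G₁ = pendant P c

      last-buildable : Buildable G₁ (last P) N
      last-buildable = <⇒≢ (last<N P) , λ
        { (here (inj₁ (eq , _))) → contradiction (vertex-inj P eq) λ ()
        ; (here (inj₂ (eq , _))) → <⇒≢ (first<N P) eq
        ; (there any)            → proj₂ (buildable-fresh (valid P) (last<N P)) any
        }

      module _ (c′ : ℕ) where

        G₂ = colouredEdge (last P) N c′ ∷ G₁

        valid₂ : Valid (suc N) G₂
        valid₂ = valid-∷ c′ last-buildable (m<n⇒m<1+n (last<N P)) ≤-refl (valid (keep P c))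

        badLast : ∀ a → miss G₂ (last P) S < a → a + a + b ≤ t → Goal t G₂
        badLast (suc a) (s≤s la) le =
          closeCycle t a b (reboard ≤-refl valid₂ there (keep P c)) 3≤k la
            (≤-trans (miss-∷ _ G₁ _ S) (≤-trans (miss-∷ _ G _ S) fb))
            (subst (_≤ t) (lemma a b) le)
          where
          lemma : ∀ a b → suc a + suc a + b ≡ 2 + (a + a + b)
          lemma = solve-∀

      reply₂ : c ∉ S → ∀ c′ → ProperColour G₁ (last P) N c′ → Goal t (G₂ c′)
      reply₂ c∉S c′ proper with _∈?_ _≟_ c′ S
      ... | yes c′∈S = badLast c′ a
        (<-≤-trans (miss-< c′∈S (inj₁ refl) (properˡ proper)) (≤-trans (miss-∷ _ G _ S) la)) le
      ... | no c′∉S = done (cycleCopy (reboard ≤-refl (valid₂ c′) there (extend P c∉S)) 3≤k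
        (has-new {G₁})
        -- The two closing edges meet at `N`, so their colours `c` and `c′` differ.
        λ { (here eq)   → properʳ proper (here (inj₂ refl , sym eq))
          ; (there c′∈) → c′∉S c′∈ })

      badFirst : ∀ b → miss G₁ (first P) S < b → a + a + b ≤ t → Goal (suc t) G₁
      badFirst (suc b) (s≤s fb) le =
        closeCycle (suc t) a b (keep P c) 3≤k (≤-trans (miss-∷ _ G _ S) la) fb
          (s≤s (subst (_≤ t) (+-suc (a + a) b) le))

    reply₁ : ∀ c → ProperColour G (first P) N c → Goal (suc t) (G₁ c)
    reply₁ c proper with _∈?_ _≟_ c S
    ... | yes c∈S = badFirst c b (<-≤-trans (miss-< c∈S (inj₁ refl) (properˡ proper)) fb) le
    ... | no c∉S  = build (last P) N (last-buildable c) (reply₂ c c∉S)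

  -- The path has j edges and lacks q before it can be closed by two further edges.
  cycleCost : (j q : ℕ) → ℕ
  cycleCost j zero    = 2
  cycleCost j (suc q) = 2 + j + cycleCost (suc j) q

  -- Besides the final 2, the summands of `cycleCost j q` are the numbers from `2 + j` to
  -- `1 + j + q`; they continue the sum of the numbers up to `1 + j`, which is `(2 + j) C 2`.
  cycleCost-C : ∀ j q → cycleCost j q + (2 + j) C 2 ≡ 2 + (2 + (j + q)) C 2
  cycleCost-C j zero    = cong (λ n → 2 + (2 + n) C 2) (sym (+-identityʳ j))
  cycleCost-C j (suc q) = begin-equality
    2 + j + cycleCost (suc j) q + (2 + j) C 2    ≡⟨ lemma (2 + j) (cycleCost (suc j) q) ((2 + j) C 2) ⟩
    cycleCost (suc j) q + (2 + j + (2 + j) C 2)  ≡⟨ cong (cycleCost (suc j) q +_) ([1+n]C2 (2 + j)) ⟨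
    cycleCost (suc j) q + (3 + j) C 2            ≡⟨ cycleCost-C (suc j) q ⟩
    2 + (3 + j + q) C 2                          ≡⟨ cong (λ n → 2 + (2 + n) C 2) (+-suc j q) ⟨
    2 + (2 + (j + suc q)) C 2                    ∎
    where
    open ≤-Reasoning
    lemma : ∀ a b c → a + b + c ≡ b + (a + c)
    lemma = solve-∀

  -- Here a and b bound the numbers of colours missing at the last and the first end.
  -- Only the first end is extended, and the path is turned round once nothing is
  -- missing there. Hence each extension raising a is one where Painter passed up
  -- a repetition, which saves the edge needed for the double cost of closing;
  -- the one exception is a = b = 0, and the max with 1 pays for it.
  mutual

    forcesCycle : ∀ {N G j q k S} t a b (P : RainbowPath N G (suc j) S) (3≤k : 3 ≤ k) → 3 + (j + q) ≡ k →
                  miss G (last P) S ≤ a → miss G (first P) S ≤ b →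
                  cycleCost (suc j) q + (a + b + (a ⊔ 1)) ≤ t → Forces (cycle k 3≤k) t G
    forcesCycle {j = j} {zero} t a b P 3≤k refl la fb le
      rewrite +-identityʳ j = closeCycle t a b P 3≤k la fb (begin
        2 + (a + a + b)         ≡⟨ cong (2 +_) (lemma a b) ⟩
        2 + (a + b + a)         ≤⟨ +-monoʳ-≤ 2 (+-monoʳ-≤ (a + b) (m≤m⊔n a 1)) ⟩
        2 + (a + b + (a ⊔ 1))   ≤⟨ le ⟩
        t                       ∎)
      where
      open ≤-Reasoning
      lemma : ∀ a b → a + a + b ≡ a + b + a
      lemma = solve-∀
    forcesCycle {q = suc q} t a       (suc b) P 3≤k k≡ la fb le = extendFirst t a b P 3≤k k≡ la fb le
    forcesCycle {G = G} {j} {suc q} {S = S} t (suc a) zero P 3≤k k≡ la fb le =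
      -- After the turn only `0 ⊔ 1` is reserved for the double cost, in place of `suc a ⊔ 1`, so
      -- the budget still suffices.
      extendFirst t 0 a (reverse P) 3≤k k≡
        (subst (λ u → miss G u S ≤ 0) (sym (last-reverse P)) fb) la
        (≤-trans (+-monoʳ-≤ (cycleCost (suc j) (suc q)) (begin
          suc a + 1              ≤⟨ +-mono-≤ (m≤m+n (suc a) 0) (m≤n⊔m (suc a) 1) ⟩
          suc a + 0 + (suc a ⊔ 1) ∎)) le)
      where open ≤-Reasoning
    forcesCycle {N} {G} {j} {suc q} {k} {S} (suc t) zero zero P 3≤k k≡ la fb (s≤s le) =
      build (first P) N (pendant-buildable P) reply
      where
      reply : ∀ c → ProperColour G (first P) N c → Forces (cycle k 3≤k) t (pendant P c)
      reply c proper with _∈?_ _≟_ c S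
      -- No colour of the path is missing at its first end, so Painter cannot repeat one.
      ... | yes c∈S = contradiction
        (<-≤-trans (miss-< {colouredEdge (first P) N c} {G} c∈S (inj₁ refl) (properˡ proper)) fb) λ ()
      ... | no c∉S = forcesCycle t 1 (suc j) (extend P c∉S) 3≤k (trans (cong (3 +_) (sym (+-suc j q))) k≡)
        (≤-trans (miss-new (pendant P c) _ c S) (s≤s (≤-trans (miss-∷ _ G _ S) la)))
        (miss-fresh P c)
        (≤-trans (≤-reflexive (lemma j (cycleCost (2 + j) q))) le)
        where
        lemma : ∀ j x → x + (1 + suc j + 1) ≡ suc (suc j) + x + 1
        lemma = solve-∀

    extendFirst : ∀ {N G j q k S} t a b (P : RainbowPath N G (suc j) S) (3≤k : 3 ≤ k) → 3 + (j + suc q) ≡ k →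
                  miss G (last P) S ≤ a → miss G (first P) S ≤ suc b →
                  cycleCost (suc j) (suc q) + (a + suc b + (a ⊔ 1)) ≤ t → Forces (cycle k 3≤k) t G
    extendFirst {N} {G} {j} {q} {k} {S} (suc t) a b P 3≤k k≡ la fb (s≤s le) =
      build (first P) N (pendant-buildable P) reply
      where
      open ≤-Reasoning
      lemma₁ : ∀ j x a b m → 3 + j + x + (a + b + m) ≡ 2 + j + x + (a + suc b + m)
      lemma₁ = solve-∀
      lemma₂ : ∀ j x a → x + (suc a + suc j + suc a) ≡ 2 + j + x + (a + 1 + a)
      lemma₂ = solve-∀

      reply : ∀ c → ProperColour G (first P) N c → Forces (cycle k 3≤k) t (pendant P c)
      reply c proper with _∈?_ _≟_ c S
      ... | yes c∈S = forcesCycle {q = suc q} t a b (keep P c) 3≤k k≡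
        (≤-trans (miss-∷ _ G _ S) la)
        (≤-pred (<-≤-trans (miss-< c∈S (inj₁ refl) (properˡ proper)) fb))
        (≤-trans (≤-reflexive (lemma₁ j (cycleCost (2 + j) q) a b (a ⊔ 1))) le)
      -- The charge `3 + j` for this extension pays for its edge, for the `suc j` colours that may
      -- be missing at the new first end and for one rise of `a`; the second rise of `a` takes the
      -- unit in `suc b`.
      ... | no c∉S = forcesCycle t (suc a) (suc j) (extend P c∉S) 3≤k (trans (cong (3 +_) (sym (+-suc j q))) k≡)
        (≤-trans (miss-new (pendant P c) _ c S) (s≤s (≤-trans (miss-∷ _ G _ S) la)))
        (miss-fresh P c)
        (begin
          cycleCost (2 + j) q + (suc a + suc j + (suc a ⊔ 1))
            ≡⟨ cong (λ m → cycleCost (2 + j) q + (suc a + suc j + m)) (m≥n⇒m⊔n≡m (s≤s {n = a} z≤n)) ⟩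
          cycleCost (2 + j) q + (suc a + suc j + suc a)
            ≡⟨ lemma₂ j (cycleCost (2 + j) q) a ⟩
          2 + j + cycleCost (2 + j) q + (a + 1 + a)
            ≤⟨ +-monoʳ-≤ (2 + j + cycleCost (2 + j) q)
                 (+-mono-≤ (+-monoʳ-≤ a (s≤s {n = b} z≤n)) (m≤m⊔n a 1)) ⟩
          2 + j + cycleCost (2 + j) q + (a + suc b + (a ⊔ 1))
            ≤⟨ le ⟩
          t ∎)

  forces-cycle : ∀ q (3≤k : 3 ≤ 3 + q) → Forces (cycle (3 + q) 3≤k) ((3 + q) C 2 + 1) []
  forces-cycle q 3≤k rewrite +-comm ((3 + q) C 2) 1 =
    -- Both ends of a single edge see its colour, so the strategy starts with bounds 0 and 0. It
    -- then needs `cycleCost 1 q + 1` edges, which is `(3 + q) C 2`.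
    build 0 1 (pendant-buildable trivial) λ c _ →
      forcesCycle {q = q} _ 0 0 (extend trivial λ ()) 3≤k refl
        (≤-reflexive (miss-seen {pendant trivial c} (here (inj₁ refl , refl)) []))
        (miss-fresh trivial c)
        (≤-reflexive (+-cancelʳ-≡ 2 _ _ (trans (+-assoc (cycleCost 1 q) 1 2)
          (trans (cycleCost-C 1 q) (+-comm 2 _)))))

-- Degrees, edge counts and greedy orders

module Degree (H : Graph) where

  V : Set
  V = Fin (order H)

  link : V → V → ℕ
  link v u with adj? H v u
  ... | yes _ = 1
  ... | no  _ = 0

  link-adj : ∀ {v u} → Adj H v u → link v u ≡ 1
  link-adj {v} {u} a with adj? H v u
  ... | yes _ = refl
  ... | no ¬a = contradiction a ¬a

  link-¬adj : ∀ {v u} → ¬ Adj H v u → link v u ≡ 0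
  link-¬adj {v} {u} ¬a with adj? H v u
  ... | yes a = contradiction a ¬a
  ... | no _  = refl

  link-irrefl : ∀ v → link v v ≡ 0
  link-irrefl v = link-¬adj (irrefl H refl)

  link-sym : ∀ v u → link v u ≡ link u v
  link-sym v u with adj? H v u
  ... | yes a = sym (link-adj (adjSym H a))
  ... | no ¬a = sym (link-¬adj (¬a ∘ adjSym H))

  link≤1 : ∀ v u → link v u ≤ 1
  link≤1 v u with adj? H v u
  ... | yes _ = ≤-refl
  ... | no  _ = z≤n

  degree : V → List V → ℕ
  degree v us = sum (map (link v) us)

  degree-↭ : ∀ v {us ws} → us ↭ ws → degree v us ≡ degree v ws
  degree-↭ v p = sum-↭ (map⁺ (link v) p)

  degree≤length : ∀ v us → degree v us ≤ length us
  degree≤length v []       = z≤n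
  degree≤length v (u ∷ us) = +-mono-≤ (link≤1 v u) (degree≤length v us)

  -- Counts every edge within the list at its earlier endpoint; `backward []` counts it at its later
  -- one.
  forward : List V → ℕ
  forward []       = 0
  forward (v ∷ vs) = degree v vs + forward vs

  backward : List V → List V → ℕ
  backward us []       = 0
  backward us (v ∷ vs) = degree v us + backward (v ∷ us) vs

  private
    cross : List V → List V → ℕ
    cross us vs = sum (map (λ v → degree v us) vs)

    cross-∷ : ∀ u us vs → cross (u ∷ us) vs ≡ degree u vs + cross us vs
    cross-∷ u us []       = refl
    cross-∷ u us (v ∷ vs) = trans
      (cong₂ (λ a b → a + degree v us + b) (link-sym v u) (cross-∷ u us vs))
      (+-interchange′ (link u v) (degree v us) (degree u vs) (cross us vs))
      where
      +-interchange′ : ∀ a b c d → a + b + (c + d) ≡ a + c + (b + d)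
      +-interchange′ = solve-∀

    -- Double counting: an edge inside `vs` may be counted from either end, and the edges from `vs`
    -- back to `us` form the additional term.
    backward-cross : ∀ us vs → backward us vs ≡ forward vs + cross us vs
    backward-cross us []       = refl
    backward-cross us (v ∷ vs) = trans
      (cong (degree v us +_) (trans (backward-cross (v ∷ us) vs) (cong (forward vs +_) (cross-∷ v us vs))))
      (lemma (degree v us) (forward vs) (degree v vs) (cross us vs))
      where
      lemma : ∀ a b c d → a + (b + (c + d)) ≡ c + b + (a + d)
      lemma = solve-∀

    cross-[] : ∀ vs → cross [] vs ≡ 0
    cross-[] []       = refl
    cross-[] (v ∷ vs) = cross-[] vs

  backward≡forward : ∀ vs → backward [] vs ≡ forward vs
  backward≡forward vs = trans (backward-cross [] vs)
    (trans (cong (forward vs +_) (cross-[] vs)) (+-identityʳ _))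

  forward-↭ : ∀ {us vs} → us ↭ vs → forward us ≡ forward vs
  forward-↭ Perm.refl                  = refl
  forward-↭ (prep v p)                 = cong₂ _+_ (degree-↭ v p) (forward-↭ p)
  forward-↭ (swap {us} {vs} u v p)     = trans
    (lemma (link u v) (degree u us) (degree v us) (forward us))
    (cong₂ _+_ (cong₂ _+_ (link-sym u v) (degree-↭ v p)) (cong₂ _+_ (degree-↭ u p) (forward-↭ p)))
    where
    lemma : ∀ a b c d → a + b + (c + d) ≡ a + c + (b + d)
    lemma = solve-∀
  forward-↭ (Perm.trans p q)           = trans (forward-↭ p) (forward-↭ q)

  -- The head has at most `n` edges to the `n` later vertices, and `2 * n` is less than the gap
  -- between consecutive squares.
  2*forward≤ : ∀ vs → 2 * forward vs ≤ length vs * length vs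
  2*forward≤ []       = z≤n
  2*forward≤ (v ∷ vs) = begin
    2 * (degree v vs + forward vs)        ≡⟨ *-distribˡ-+ 2 (degree v vs) _ ⟩
    2 * degree v vs + 2 * forward vs      ≤⟨ +-mono-≤ (*-monoʳ-≤ 2 (degree≤length v vs)) (2*forward≤ vs) ⟩
    2 * n + n * n                         ≤⟨ n≤1+n _ ⟩
    suc (2 * n + n * n)                   ≡⟨ lemma n ⟩
    suc n * suc n                         ∎
    where
    open ≤-Reasoning
    n = length vs
    lemma : ∀ n → suc (2 * n + n * n) ≡ suc n * suc n
    lemma = solve-∀

  private
    EdgeOrder : V × V → Set
    EdgeOrder (i , j) = i Fin.< j × Adj H i j

    edgeOrder? : ∀ p → Dec (EdgeOrder p)
    edgeOrder? (i , j) = (i Fin.<? j) ×-dec adj? H i j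

    row : ∀ {v} us → All (v Fin.<_) us → length (filter edgeOrder? (map (v ,_) us)) ≡ degree v us
    row []       []       = refl
    row {v} (u ∷ us) (v<u ∷ v<us) = trans (step (adj? H v u)) (cong (link v u +_) (row us v<us))
      where
      step : Dec (Adj H v u) → length (filter edgeOrder? (map (v ,_) (u ∷ us))) ≡
                               link v u + length (filter edgeOrder? (map (v ,_) us))
      step (yes a) = trans (cong length (filter-accept edgeOrder? {xs = map (v ,_) us} (v<u , a)))
                           (cong (_+ _) (sym (link-adj a)))
      step (no ¬a) = trans (cong length (filter-reject edgeOrder? {xs = map (v ,_) us} (¬a ∘ proj₂)))
                           (cong (_+ _) (sym (link-¬adj ¬a)))

    -- Since `u` is smaller than all of `vs`, its column holds only pairs in the wrong order, and
    -- the filter drops them.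
    column : ∀ {u} us vs → All (u Fin.<_) vs →
      length (filter edgeOrder? (cartesianProduct vs (u ∷ us))) ≡
      length (filter edgeOrder? (cartesianProduct vs us))
    column us []       []           = refl
    column {u} us (v ∷ vs) (u<v ∷ u<vs) = begin-equality
      length (filter edgeOrder? ((v , u) ∷ map (v ,_) us ++ cartesianProduct vs (u ∷ us)))
        ≡⟨ cong length (filter-reject edgeOrder? {xs = map (v ,_) us ++ cartesianProduct vs (u ∷ us)}
             (λ (v<u , _) → <-asym v<u u<v)) ⟩
      length (filter edgeOrder? (map (v ,_) us ++ cartesianProduct vs (u ∷ us)))
        ≡⟨ split (map (v ,_) us) _ ⟩
      length (filter edgeOrder? (map (v ,_) us)) + length (filter edgeOrder? (cartesianProduct vs (u ∷ us)))
        ≡⟨ cong (length (filter edgeOrder? (map (v ,_) us)) +_) (column us vs u<vs) ⟩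
      length (filter edgeOrder? (map (v ,_) us)) + length (filter edgeOrder? (cartesianProduct vs us))
        ≡⟨ split (map (v ,_) us) _ ⟨
      length (filter edgeOrder? (cartesianProduct (v ∷ vs) us)) ∎
      where
      open ≤-Reasoning
      split : ∀ ps qs → length (filter edgeOrder? (ps ++ qs)) ≡ length (filter edgeOrder? ps) + length (filter edgeOrder? qs)
      split ps qs = trans (cong length (filter-++ edgeOrder? ps qs)) (length-++ (filter edgeOrder? ps))

    increasing : ∀ vs → AllPairs Fin._<_ vs → length (filter edgeOrder? (cartesianProduct vs vs)) ≡ forward vs
    increasing []       []            = refl
    increasing (v ∷ vs) (v<vs ∷ inc) = begin-equality
      length (filter edgeOrder? ((v , v) ∷ map (v ,_) vs ++ cartesianProduct vs (v ∷ vs)))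
        ≡⟨ cong length (filter-reject edgeOrder? {v , v} {map (v ,_) vs ++ cartesianProduct vs (v ∷ vs)}
             (λ (_ , a) → irrefl H refl a)) ⟩
      length (filter edgeOrder? (map (v ,_) vs ++ cartesianProduct vs (v ∷ vs)))
        ≡⟨ cong length (filter-++ edgeOrder? (map (v ,_) vs) _) ⟩
      length (filter edgeOrder? (map (v ,_) vs) ++ filter edgeOrder? (cartesianProduct vs (v ∷ vs)))
        ≡⟨ length-++ (filter edgeOrder? (map (v ,_) vs)) ⟩
      length (filter edgeOrder? (map (v ,_) vs)) + length (filter edgeOrder? (cartesianProduct vs (v ∷ vs)))
        ≡⟨ cong₂ _+_ (row vs v<vs) (trans (column vs vs v<vs) (increasing vs inc)) ⟩
      forward (v ∷ vs) ∎
      where open ≤-Reasoning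

  size≡forward : size H ≡ forward (allFin (order H))
  size≡forward = increasing (allFin (order H)) (AllPairs.tabulate⁺-< id)

  2*size≤ : 2 * size H ≤ order H * order H
  2*size≤ = begin
    2 * size H            ≡⟨ cong (2 *_) size≡forward ⟩
    2 * forward vs        ≤⟨ 2*forward≤ vs ⟩
    length vs * length vs ≡⟨ cong (λ n → n * n) (length-tabulate {A = V} id) ⟩
    order H * order H     ∎
    where
    open ≤-Reasoning
    vs = allFin (order H)

  -- `degree v vs` is also the degree of `v` in `v ∷ vs`, as there are no loops; so each head has
  -- maximum degree in the graph that is left.
  data Greedy : List V → Set where
    []  : Greedy []
    _∷_ : ∀ {v vs} → All (λ u → degree u (v ∷ vs) ≤ degree v vs) vs → Greedy vs → Greedy (v ∷ vs)

  private
    maximum : (f : V → ℕ) → ∀ v vs → ∃[ u ] (u ∈ v ∷ vs × (∀ {w} → w ∈ v ∷ vs → f w ≤ f u))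
    maximum f v vs = argmax f v vs , [ here , there ]′ (argmax-sel f v vs) , λ
      { (here refl) → f[⊥]≤f[argmax] {f = f} v vs
      ; (there w∈)  → All.lookup (f[xs]≤f[argmax] {f = f} v vs) w∈
      }

  greedyOrder : ∀ n vs → length vs ≡ n → ∃[ ws ] (ws ↭ vs × Greedy ws)
  greedyOrder zero    []       _  = [] , ↭-refl , []
  greedyOrder (suc n) (v ∷ vs) eq
    with u , u∈ , max ← maximum (λ w → degree w (v ∷ vs)) v vs
    with xs , ys , split ← ∈-∃++ u∈
    with p ← ↭-trans (↭-reflexive split) (shift u xs ys)
    with ws , q , greedy ← greedyOrder n (xs ++ ys) (suc-injective (trans (sym (↭-length p)) eq)) =
    u ∷ ws , back , All.tabulate (λ {w} w∈ → begin
      degree w (u ∷ ws)         ≡⟨ degree-↭ w back ⟩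
      degree w (v ∷ vs)         ≤⟨ max (∈-resp-↭ back (there w∈)) ⟩
      degree u (v ∷ vs)         ≡⟨ degree-↭ u back ⟨
      link u u + degree u ws    ≡⟨ cong (_+ degree u ws) (link-irrefl u) ⟩
      degree u ws               ∎) ∷ greedy
    where
    open ≤-Reasoning
    back : u ∷ ws ↭ v ∷ vs
    back = ↭-trans (prep u q) (↭-sym p)

-- Embedding an arbitrary graph

module Embed (H : Graph) where

  open Degree H

  -- `weight` records the degree of the vertex into those placed after it, which bounds the cost of
  -- an attempt failing at it.
  record Placed : Set where
    constructor placed
    field
      vertex      : V
      name weight : ℕ

  open Placed

  Link : Set
  Link = Placed × Placed × ℕ

  colourOf : Link → ℕ
  colourOf (_ , _ , c) = c

  Present : Board → Link → Set
  Present G (x , y , c) = Has G (name x) (name y) c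

  Distinct : List Link → Set
  Distinct K = ∀ {p q} → p ∈ K → q ∈ K → colourOf p ≡ colourOf q → p ≡ q

  -- `E` lists the placed vertices, latest first, and `K` only the edges of the copy; wasted edges
  -- stay on the board without a link.
  record Embedding (N : ℕ) (G : Board) (E : List Placed) (K : List Link) : Set where
    field
      valid    : Valid N G
      names<N  : All (λ x → name x < N) E
      names≢   : AllPairs (λ x y → name x ≢ name y) E
      present  : All (Present G) K
      distinct : Distinct K
      covers   : ∀ {x y} → x ∈ E → y ∈ E → Adj H (vertex x) (vertex y) →
                 ∃[ c ] ((x , y , c) ∈ K ⊎ (y , x , c) ∈ K)

  names-injective : ∀ {E x y} → AllPairs (λ x y → name x ≢ name y) E → x ∈ E → y ∈ E →
                    name x ≡ name y → x ≡ y
  names-injective _        (here refl) (here refl) _  = refl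
  names-injective (h ∷ _)  (here refl) (there y∈)  eq = contradiction eq (All.lookup h y∈)
  names-injective (h ∷ _)  (there x∈)  (here refl) eq = contradiction (sym eq) (All.lookup h x∈)
  names-injective (_ ∷ hs) (there x∈)  (there y∈)  eq = names-injective hs x∈ y∈ eq

  complete⇒copy : ∀ {N G E K} → Embedding N G E K → (∀ v → ∃[ x ] (x ∈ E × vertex x ≡ v)) →
                  RainbowCopy H G
  complete⇒copy {G = G} {E} {K} M at = colouredCopy H valid {I = ∃[ p ] (p ∈ K)} φ φ-inj
    (λ ((x , _ , _) , _) → name x) (λ ((_ , y , _) , _) → name y) (colourOf ∘ proj₁)
    (λ (_ , p∈) → All.lookup present p∈)
    (λ { (_ , p∈) (_ , q∈) eq → names (distinct p∈ q∈ eq) })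
    (λ {i} {j} a →
      let x , x∈ , vx = at i ; y , y∈ , vy = at j in
      [ (λ p∈ → (_ , p∈) , inj₁ (refl , refl)) , (λ p∈ → (_ , p∈) , inj₂ (refl , refl)) ]′
      (proj₂ (covers x∈ y∈ (subst₂ (Adj H) (sym vx) (sym vy) a))))
    where
    open Embedding M
    φ : V → ℕ
    φ v = name (proj₁ (at v))

    φ-inj : ∀ {v w} → φ v ≡ φ w → v ≡ w
    φ-inj {v} {w} eq with at v | at w
    ... | x , x∈ , refl | y , y∈ , refl = cong vertex (names-injective names≢ x∈ y∈ eq)

    names : ∀ {x y c x′ y′ c′} → _≡_ {A = Link} (x , y , c) (x′ , y′ , c′) → name x ≡ name x′ × name y ≡ name y′
    names refl = refl , refl

  -- An attempt that fails at x has cost at most weight x edges, and it removes a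
  -- colour from those missing at x. With r + 1 edges to come, at most r new colours
  -- can still be missed before the last vertex is attached.
  load : Board → List ℕ → ℕ → List Placed → ℕ
  load G S r []      = 0
  load G S r (x ∷ E) = weight x * (miss G (name x) S + r) + load G S r E

  -- Bounds the edges still needed: those of the copy, those wasted at placed vertices, and those
  -- wasted at vertices of `R`, each of which may fail once for every colour of the copy except the
  -- last.
  potential : Board → List ℕ → List Placed → List V → ℕ → ℕ
  potential G S E R zero    = 0
  potential G S E R (suc r) = suc r + load G S r E + forward R * (length S + r)

  load-∷ : ∀ e G S r E → load (e ∷ G) S r E ≤ load G S r E
  load-∷ e G S r []      = z≤n
  load-∷ e G S r (x ∷ E) =
    +-mono-≤ (*-monoʳ-≤ (weight x) (+-monoˡ-≤ r (miss-∷ e G (name x) S))) (load-∷ e G S r E)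

  -- The colour of `e` stops being missing at `x`, so the factor of `weight x` falls by one.
  load-drop : ∀ {e G S x E} r → x ∈ E → colour e ∈ S → Incident e (name x) → ¬ Sees G (name x) (colour e) →
              weight x + load (e ∷ G) S r E ≤ load G S r E
  load-drop {e} {G} {S} {x} {_ ∷ E} r (here refl) c∈ inc new = begin
    weight x + (weight x * (miss (e ∷ G) (name x) S + r) + load (e ∷ G) S r E)
      ≡⟨ lemma (weight x) (miss (e ∷ G) (name x) S) r _ ⟩
    weight x * (suc (miss (e ∷ G) (name x) S) + r) + load (e ∷ G) S r E
      ≤⟨ +-mono-≤ (*-monoʳ-≤ (weight x) (+-monoˡ-≤ r (miss-< c∈ inc new))) (load-∷ e G S r E) ⟩
    weight x * (miss G (name x) S + r) + load G S r E ∎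
    where
    open ≤-Reasoning
    lemma : ∀ w m r l → w + (w * (m + r) + l) ≡ w * (suc m + r) + l
    lemma = solve-∀
  load-drop {e} {G} {S} {x} {y ∷ E} r (there x∈) c∈ inc new = begin
    weight x + (weight y * (miss (e ∷ G) (name y) S + r) + load (e ∷ G) S r E)
      ≡⟨ lemma (weight x) (weight y * (miss (e ∷ G) (name y) S + r)) _ ⟩
    weight y * (miss (e ∷ G) (name y) S + r) + (weight x + load (e ∷ G) S r E)
      ≤⟨ +-mono-≤ (*-monoʳ-≤ (weight y) (+-monoˡ-≤ r (miss-∷ e G (name y) S))) (load-drop r x∈ c∈ inc new) ⟩
    weight y * (miss G (name y) S + r) + load G S r E ∎
    where
    open ≤-Reasoning
    lemma : ∀ a b c → a + (b + c) ≡ b + (a + c)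
    lemma = solve-∀

  miss-++ : ∀ G u D S → miss G u (D ++ S) ≤ length D + miss G u S
  miss-++ G u []      S = ≤-refl
  miss-++ G u (c ∷ D) S = ≤-trans (miss-new G u c (D ++ S)) (s≤s (miss-++ G u D S))

  load-++ : ∀ G D S r E → load G (D ++ S) r E ≤ load G S (length D + r) E
  load-++ G D S r []      = z≤n
  load-++ G D S r (x ∷ E) = +-mono-≤ (*-monoʳ-≤ (weight x) (begin
    miss G (name x) (D ++ S) + r          ≤⟨ +-monoˡ-≤ r (miss-++ G (name x) D S) ⟩
    length D + miss G (name x) S + r      ≡⟨ lemma (length D) _ r ⟩
    miss G (name x) S + (length D + r)    ∎)) (load-++ G D S r E)
    where
    open ≤-Reasoning
    lemma : ∀ a b c → a + b + c ≡ b + (a + c)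
    lemma = solve-∀

  potential-∷ : ∀ e G S E R r → potential (e ∷ G) S E R r ≤ potential G S E R r
  potential-∷ e G S E R zero    = z≤n
  potential-∷ e G S E R (suc r) =
    +-monoˡ-≤ (forward R * (length S + r)) (+-monoʳ-≤ (suc r) (load-∷ e G S r E))

  potential-drop : ∀ {e G S x E} R r → x ∈ E → colour e ∈ S → Incident e (name x) →
    ¬ Sees G (name x) (colour e) →
    weight x + potential (e ∷ G) S E R (suc r) ≤ potential G S E R (suc r)
  potential-drop {e} {G} {S} {x} {E} R r x∈ c∈ inc new = begin
    weight x + (suc r + load (e ∷ G) S r E + forward R * (length S + r))
      ≡⟨ lemma (weight x) (suc r) (load (e ∷ G) S r E) _ ⟩
    suc r + (weight x + load (e ∷ G) S r E) + forward R * (length S + r)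
      ≤⟨ +-monoˡ-≤ (forward R * (length S + r)) (+-monoʳ-≤ (suc r) (load-drop r x∈ c∈ inc new)) ⟩
    suc r + load G S r E + forward R * (length S + r) ∎
    where
    open ≤-Reasoning
    lemma : ∀ a b c d → a + (b + c + d) ≡ b + (a + c) + d
    lemma = solve-∀

  -- The share of `v` moves from `forward` to `load`, and the colours of `D` pass from those to come
  -- to those in use; what remains is the drop by the `length D` edges built. The case `r ≡ 0`
  -- stands apart because the potential is then 0 by definition.
  potential-place : ∀ G D S E v R n r →
    length D + potential G (D ++ S) (placed v n (degree v R) ∷ E) R r ≤
    potential G S E (v ∷ R) (length D + r) ⊎ r ≡ 0
  potential-place G D S E v R n zero    = inj₂ refl
  potential-place G D S E v R n (suc r) = inj₁ (begin
    d + (suc r + (w * (miss G n (D ++ S) + r) + load G (D ++ S) r E) + forward R * (length (D ++ S) + r))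
      ≤⟨ +-monoʳ-≤ d (+-mono-≤ (+-monoʳ-≤ (suc r) (+-mono-≤
           (*-monoʳ-≤ w (+-monoˡ-≤ r (miss≤length G n (D ++ S)))) (load-++ G D S r E))) ≤-refl) ⟩
    d + (suc r + (w * (length (D ++ S) + r) + load G S (d + r) E) + forward R * (length (D ++ S) + r))
      ≡⟨ cong (λ l → d + (suc r + (w * (l + r) + load G S (d + r) E) + forward R * (l + r))) (length-++ D) ⟩
    d + (suc r + (w * (d + length S + r) + load G S (d + r) E) + forward R * (d + length S + r))
      ≡⟨ lemma d r w (length S) (load G S (d + r) E) (forward R) ⟩
    suc (d + r) + load G S (d + r) E + (w + forward R) * (length S + (d + r))
      ≡⟨ cong (potential G S E (v ∷ R)) (+-suc d r) ⟨
    potential G S E (v ∷ R) (d + suc r) ∎)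
    where
    open ≤-Reasoning
    d = length D
    w = degree v R
    lemma : ∀ d r w s l f → d + (suc r + (w * (d + s + r) + l) + f * (d + s + r)) ≡
                            suc (d + r) + l + (w + f) * (s + (d + r))
    lemma = solve-∀

  -- v has at most weight x neighbours among x, the vertices placed after x, and
  -- a further vertices. The list is ordered with the latest vertex first.
  Dominated : V → ℕ → List Placed → Set
  Dominated v a []      = ⊤
  Dominated v a (x ∷ E) = a + link v (vertex x) ≤ weight x × Dominated v (a + link v (vertex x)) E

  -- One attempt to place `v` at the fresh name `N`, with both outcomes as parameters: `retry` after
  -- a repeated colour, `place` once all earlier neighbours are joined. `T` is the budget at the
  -- start, and `t < T` makes the repetition of attempts well-founded.
  module Attach (N : ℕ) (E : List Placed) (K : List Link) (v : V) (R : List V) (n r T : ℕ)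
    (distinctᴷ : Distinct K) (names<N : All (λ x → name x < N) E)
    (retry : ∀ {t G} → t < T → Valid (suc N) G → All (Present G) K →
             potential G (map colourOf K) E (v ∷ R) n ≤ t → Forces H t G)
    (place : ∀ {t G D} → Valid (suc N) G → All (Present G) (D ++ K) → Distinct (D ++ K) →
             (∀ {y} → y ∈ E → Adj H v (vertex y) → ∃[ c ] ((placed v N (degree v R) , y , c) ∈ D)) →
             n ≡ length D + r → potential G (map colourOf K) E (v ∷ R) n ≤ t + length D →
             Forces H t G)
    where

    self : Placed
    self = placed v N (degree v R)

    S : List ℕ
    S = map colourOf K

    -- `F` holds the placed vertices still to be considered and `D` the links made in this attempt.
    -- The sum `t + length D` stays constant while the attempt succeeds: its edges are charged only
    -- at the end, as part of the copy or as waste.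
    attach : ∀ F {t G a} D → (∀ {x} → x ∈ F → x ∈ E) → AllPairs (λ x y → name x ≢ name y) F →
      All (λ x → Buildable G (name x) N) F → t ≤ T →
      Valid (suc N) G → All (Present G) (D ++ K) → Distinct (D ++ K) → All (Sees G N ∘ colourOf) D →
      (∀ {y} → y ∈ E → Adj H v (vertex y) → y ∈ F ⊎ ∃[ c ] ((self , y , c) ∈ D)) →
      Dominated v a F → length D ≤ a →
      n ≡ length D + (degree v (map vertex F) + r) → potential G S E (v ∷ R) n ≤ t + length D →
      Forces H t G
    attach [] D F⊆E _ _ t≤T V pres dist seen cov _ _ n≡ pot =
      place {D = D} V pres dist (λ y∈ a → [ (λ ()) , id ]′ (cov y∈ a)) n≡ pot
    attach (x ∷ F) {t} {G} {a} D F⊆E (x≢F ∷ names≢) (bx ∷ bF) t≤T V pres dist seen cov (dom , doms) D≤a n≡ pot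
      with adj? H v (vertex x)
    ... | no ¬a = attach F D (F⊆E ∘ there) names≢ bF t≤T V pres dist seen cov′ doms
                    (≤-trans D≤a (m≤m+n a 0)) n≡ pot
      where
      cov′ : ∀ {y} → y ∈ E → Adj H v (vertex y) → y ∈ F ⊎ ∃[ c ] ((self , y , c) ∈ D)
      cov′ y∈ a with cov y∈ a
      ... | inj₁ (here refl) = contradiction a ¬a
      ... | inj₁ (there y∈F) = inj₁ y∈F
      ... | inj₂ found       = inj₂ found
    ... | yes adj = attempt t t≤T pot
      where
      d q : ℕ
      d = length D
      q = d + (degree v (map vertex F) + r)

      n≡1+q : n ≡ suc q
      n≡1+q = trans n≡ (+-suc d _)

      d<n : d < n
      d<n = subst (d <_) (sym n≡1+q) (s≤s (m≤m+n d _))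

      n≤potential : ∀ m → m ≤ potential G S E (v ∷ R) m
      n≤potential zero    = z≤n
      n≤potential (suc m) = ≤-trans (m≤m+n (suc m) _) (m≤m+n _ _)

      attempt : ∀ t → t ≤ T → potential G S E (v ∷ R) n ≤ t + d → Forces H t G
      -- The potential is at least the number `n` of edges to come, of which only `d < n` are built,
      -- so the budget cannot be exhausted here.
      attempt zero    _   pot = contradiction (<-≤-trans d<n (≤-trans (n≤potential n) pot)) (<-irrefl refl)
      attempt (suc t) t<T pot = build (name x) N bx reply
        where
        module _ (c : ℕ) (proper : ProperColour G (name x) N c) where

          G′ = colouredEdge (name x) N c ∷ G

          valid′ : Valid (suc N) G′
          valid′ = valid-∷ c bx (m<n⇒m<1+n (All.lookup names<N (F⊆E (here refl)))) ≤-refl V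

          present′ : All (Present G′) (D ++ K)
          present′ = All.map (has-⊆ there) pres

          failed : c ∈ S → Forces H t G′
          failed c∈S = retry t<T valid′ (All.++⁻ʳ D present′)
            (+-cancelˡ-≤ (suc d) _ _ (begin
              suc d + potential G′ S E (v ∷ R) n
                -- The `d` neighbours joined so far were placed after `x`; together with `x` they
                -- number at most `weight x` by domination.
                ≤⟨ +-monoˡ-≤ _ (≤-trans (s≤s D≤a) (≤-trans (≤-reflexive (+-comm 1 a)) dom)) ⟩
              weight x + potential G′ S E (v ∷ R) n
                ≡⟨ cong (λ m → weight x + potential G′ S E (v ∷ R) m) n≡1+q ⟩
              weight x + potential G′ S E (v ∷ R) (suc q)
                ≤⟨ potential-drop (v ∷ R) q (F⊆E (here refl)) c∈S (inj₁ refl) (properˡ proper) ⟩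
              potential G S E (v ∷ R) (suc q)
                ≡⟨ cong (potential G S E (v ∷ R)) n≡1+q ⟨
              potential G S E (v ∷ R) n
                ≤⟨ pot ⟩
              suc t + d
                ≡⟨ cong suc (+-comm t d) ⟩
              suc d + t ∎))
            where open ≤-Reasoning

          fresh : c ∉ S → ∀ {p} → p ∈ D ++ K → c ≢ colourOf p
          fresh c∉S p∈ refl with ∈-++⁻ D p∈
          -- All edges of the attempt meet at `N`, so properness excludes their colours.
          ... | inj₁ p∈D = properʳ proper (All.lookup seen p∈D)
          ... | inj₂ p∈K = c∉S (∈-map⁺ colourOf p∈K)

          distinct′ : c ∉ S → Distinct ((self , x , c) ∷ D ++ K)
          distinct′ c∉S (here refl) (here refl) _  = refl
          distinct′ c∉S (here refl) (there q∈)  eq = contradiction eq (fresh c∉S q∈)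
          distinct′ c∉S (there p∈)  (here refl) eq = contradiction (sym eq) (fresh c∉S p∈)
          distinct′ c∉S (there p∈)  (there q∈)  eq = dist p∈ q∈ eq

          buildable′ : ∀ {y} → name x ≢ name y → Buildable G (name y) N → Buildable G′ (name y) N
          buildable′ x≢y (y≢N , new) = y≢N , λ
            { (here (inj₁ (eq , _))) → x≢y eq
            ; (here (inj₂ (_ , eq))) → y≢N (sym eq)
            ; (there any)            → new any
            }

          covers′ : ∀ {y} → y ∈ E → Adj H v (vertex y) →
                    y ∈ F ⊎ ∃[ c′ ] ((self , y , c′) ∈ (self , x , c) ∷ D)
          covers′ y∈ a with cov y∈ a
          ... | inj₁ (here refl)  = inj₂ (c , here refl)
          ... | inj₁ (there y∈F)  = inj₁ y∈F
          ... | inj₂ (c′ , found) = inj₂ (c′ , there found)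

          succeeded : c ∉ S → Forces H t G′
          succeeded c∉S = attach F ((self , x , c) ∷ D) (F⊆E ∘ there) names≢
            (All.zipWith (λ {y} (x≢y , b) → buildable′ {y} x≢y b) (x≢F , bF)) (<⇒≤ t<T) valid′
            (has-sym {G′} (has-new {G}) ∷ present′) (distinct′ c∉S)
            (here (inj₂ refl , refl) ∷ All.map there seen) covers′ doms
            (≤-trans (s≤s D≤a) (≤-reflexive (+-comm 1 a))) n≡1+q
            (≤-trans (potential-∷ _ G S E (v ∷ R) n) (≤-trans pot (≤-reflexive (sym (+-suc t d)))))

        reply : ∀ c → ProperColour G (name x) N c → Forces H t (colouredEdge (name x) N c ∷ G)
        reply c proper with _∈?_ _≟_ c S
        ... | yes c∈S = failed c proper c∈S
        ... | no c∉S  = succeeded c proper c∉S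

  -- Induction on the vertices not yet placed. Domination starts its count at `degree v R`, so
  -- neighbours not yet placed are included.
  forcesRest : ∀ R {N G E K t} → Embedding N G E K →
    (∀ v → v ∈ R ⊎ ∃[ x ] (x ∈ E × vertex x ≡ v)) → Greedy R →
    All (λ v → Dominated v (degree v R) E) R →
    potential G (map colourOf K) E R (backward (map vertex E) R) ≤ t → Forces H t G
  forcesRest [] M at _ _ _ = done (complete⇒copy M (λ v → [ (λ ()) , id ]′ (at v)))
  forcesRest (v ∷ R) {E = E} {K} M at (greedy ∷ greedys) (dom ∷ doms) pot =
    stage (<-wellFounded _) valid names<N present pot
    where
    open Embedding M
    n = backward (map vertex E) (v ∷ R)
    r = backward (v ∷ map vertex E) R

    place : ∀ {N t G D} → All (λ x → name x < N) E → Valid (suc N) G → All (Present G) (D ++ K) →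
      Distinct (D ++ K) →
      (∀ {y} → y ∈ E → Adj H v (vertex y) → ∃[ c ] ((placed v N (degree v R) , y , c) ∈ D)) →
      n ≡ length D + r → potential G (map colourOf K) E (v ∷ R) n ≤ t + length D → Forces H t G
    place {N} {t} {G} {D} names<N V pres dist cov n≡ pot = forcesRest R (record
      { valid    = V
      ; names<N  = ≤-refl ∷ All.map m<n⇒m<1+n names<N
      ; names≢   = All.map (λ n<N eq → <⇒≢ n<N (sym eq)) names<N ∷ names≢
      ; present  = pres
      ; distinct = dist
      ; covers   = covers′
      }) at′ greedys
      (All.zipWith (λ {u} (g , h) → dominated u g h) (greedy , doms)) budget
      where
      self : Placed
      self = placed v N (degree v R)

      covers′ : ∀ {x y} → x ∈ self ∷ E → y ∈ self ∷ E → Adj H (vertex x) (vertex y) →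
                ∃[ c ] ((x , y , c) ∈ D ++ K ⊎ (y , x , c) ∈ D ++ K)
      covers′ (here refl) (here refl) a = contradiction a (irrefl H refl)
      covers′ (here refl) (there y∈)  a = let c , found = cov y∈ a in c , inj₁ (∈-++⁺ˡ found)
      covers′ (there x∈)  (here refl) a = let c , found = cov x∈ (adjSym H a) in c , inj₂ (∈-++⁺ˡ found)
      covers′ (there x∈)  (there y∈)  a = let c , found = covers x∈ y∈ a in
        c , Sum.map (∈-++⁺ʳ D) (∈-++⁺ʳ D) found

      at′ : ∀ u → u ∈ R ⊎ ∃[ x ] (x ∈ self ∷ E × vertex x ≡ u)
      at′ u with at u
      ... | inj₁ (here refl)    = inj₂ (self , here refl , refl)
      ... | inj₁ (there u∈R)    = inj₁ u∈R
      ... | inj₂ (x , x∈ , eq)  = inj₂ (x , there x∈ , eq)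

      -- The greedy choice of `v` is exactly the condition at the vertex just placed; the conditions
      -- at older vertices carry over.
      dominated : ∀ u → degree u (v ∷ R) ≤ degree v R → Dominated u (degree u (v ∷ R)) E →
                  Dominated u (degree u R) (self ∷ E)
      dominated u g h rewrite +-comm (link u v) (degree u R) = g , h

      budget : potential G (map colourOf (D ++ K)) (self ∷ E) R r ≤ t
      budget rewrite map-++ colourOf D K
        with potential-place G (map colourOf D) (map colourOf K) E v R N r
      ... | inj₂ r≡0 rewrite r≡0 = z≤n
      ... | inj₁ le  = +-cancelˡ-≤ (length D) _ _ (begin
        length D + potential G (map colourOf D ++ map colourOf K) (self ∷ E) R r
          ≡⟨ cong (_+ potential G (map colourOf D ++ map colourOf K) (self ∷ E) R r) (length-map colourOf D) ⟨
        length (map colourOf D) + potential G (map colourOf D ++ map colourOf K) (self ∷ E) R r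
          ≤⟨ le ⟩
        potential G (map colourOf K) E (v ∷ R) (length (map colourOf D) + r)
          ≡⟨ cong (potential G (map colourOf K) E (v ∷ R)) (trans n≡ (cong (_+ r) (sym (length-map colourOf D)))) ⟨
        potential G (map colourOf K) E (v ∷ R) (n)
          ≤⟨ pot ⟩
        t + length D
          ≡⟨ +-comm t _ ⟩
        length D + t ∎)
        where open ≤-Reasoning

    -- A failed attempt leaves `K` as it was, and the next one uses the next fresh name; induction
    -- on the remaining budget covers all failures.
    stage : ∀ {N G t} → Acc _<_ t → Valid N G → All (λ x → name x < N) E → All (Present G) K →
            potential G (map colourOf K) E (v ∷ R) n ≤ t → Forces H t G
    stage {N} {G} {t} (acc rs) V names<N pres pot =
      Attach.attach N E K v R n r t distinct names<N
        (λ t′<t V′ → stage (rs t′<t) V′ (All.map m<n⇒m<1+n names<N)) (place names<N)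
        E [] id names≢ (All.map (buildable-fresh V) names<N) ≤-refl
        (valid-mono (n≤1+n N) V) pres distinct [] (λ y∈ _ → inj₁ y∈) dom z≤n refl
        (≤-trans pot (m≤m+n t 0))

  forces-size² : Forces H (size H ^ 2) []
  forces-size² with greedyOrder (order H) (allFin (order H)) (length-tabulate id)
  ... | R , R↭ , greedy = forcesRest R (record
      { valid    = valid-[] {0}
      ; names<N  = []
      ; names≢   = []
      ; present  = []
      ; distinct = λ ()
      ; covers   = λ ()
      }) (λ v → inj₁ (∈-resp-↭ (↭-sym R↭) (∈-allFin v))) greedy (All.tabulate λ _ → tt)
      (subst (λ k → potential [] [] [] R k ≤ size H ^ 2) size≡backward initial)
    where
    open ≤-Reasoning
    size≡forward′ : size H ≡ forward R
    size≡forward′ = trans size≡forward (sym (forward-↭ R↭))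

    size≡backward : size H ≡ backward [] R
    size≡backward = trans size≡forward′ (sym (backward≡forward R))

    initial′ : ∀ k → k ≡ forward R → potential [] [] [] R k ≤ k ^ 2
    initial′ zero    _  = z≤n
    -- Here `suc k` edges form the copy, and `forward R`, which is `suc k`, is multiplied by the `k`
    -- colours that can be repeated.
    initial′ (suc k) eq rewrite sym eq = ≤-reflexive (lemma k)
      where
      lemma : ∀ k → suc k + 0 + suc k * k ≡ suc k * (suc k * 1)
      lemma = solve-∀

    initial : potential [] [] [] R (size H) ≤ size H ^ 2
    initial = initial′ (size H) size≡forward′

-- Absence of isolated vertices and the four bounds

path-noIsolated : ∀ k → NoIsolated (path (suc k))
path-noIsolated k zero    = suc zero , inj₁ refl
path-noIsolated k (suc i) = inject₁ i , inj₂ (cong suc (Fin.toℕ-inject₁ i))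

cycle-noIsolated : ∀ q (3≤k : 3 ≤ 3 + q) → NoIsolated (cycle (3 + q) 3≤k)
cycle-noIsolated q 3≤k zero    = suc zero , inj₁ (inj₁ refl)
cycle-noIsolated q 3≤k (suc i) = inject₁ i , inj₂ (inj₁ (cong suc (Fin.toℕ-inject₁ i)))

complete-noIsolated : ∀ n → NoIsolated (complete (2 + n))
complete-noIsolated n zero    = suc zero , λ ()
complete-noIsolated n (suc i) = zero , λ ()

4*size²≤ : ∀ H → 4 * size H ^ 2 ≤ order H ^ 4
4*size²≤ H = begin
  4 * size H ^ 2                          ≡⟨ lemma₁ (size H) ⟩
  2 * size H * (2 * size H)               ≤⟨ *-mono-≤ (Degree.2*size≤ H) (Degree.2*size≤ H) ⟩
  order H * order H * (order H * order H) ≡⟨ lemma₂ (order H) ⟩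
  order H ^ 4                             ∎
  where
  open ≤-Reasoning
  lemma₁ : ∀ k → 4 * (k * (k * 1)) ≡ 2 * k * (2 * k)
  lemma₁ = solve-∀
  lemma₂ : ∀ n → n * n * (n * n) ≡ n * (n * (n * (n * 1)))
  lemma₂ = solve-∀

theorem17 : ((k : ℕ) (H : Graph) → size H ≡ k → NoIsolated H →
    ∃[ a ] (IsARₒ H a × a ≤ k ^ 2))
    × ((k : ℕ) → 1 ≤ k →
    ∃[ a ] (IsARₒ (path k) a × a ≤ (k C 2) + 1))
    × ((k : ℕ) (3≤k : 3 ≤ k) →
    ∃[ a ] (IsARₒ (cycle k 3≤k) a × a ≤ (k C 2) + 1))
    × ((n : ℕ) → 2 ≤ n →
    ∃[ a ] (IsARₒ (complete n) a × 4 * a ≤ n ^ 4))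
theorem17 =
    (λ { _ H refl noIsolated → forces⇒ARₒ≤ H noIsolated (Embed.forces-size² H) })
  , (λ { (suc k) _ → forces⇒ARₒ≤ (path (suc k)) (path-noIsolated k) (Paths.forces-path k) })
  , (λ { (suc zero) (s≤s ())
       ; (suc (suc zero)) (s≤s (s≤s ()))
       ; (suc (suc (suc q))) 3≤k → forces⇒ARₒ≤ (cycle (3 + q) 3≤k) (cycle-noIsolated q 3≤k) (Paths.forces-cycle q 3≤k) })
  , λ { (suc zero) (s≤s ())
      ; (suc (suc n)) _ →
          let K = complete (2 + n)
              a , isARₒ , a≤ = forces⇒ARₒ≤ K (complete-noIsolated n) (Embed.forces-size² K)
          in a , isARₒ , ≤-trans (*-monoʳ-≤ 4 a≤) (4*size²≤ K)
      }
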